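{- Consider the objectives $\mathsf{Energy}_{LU}(U,0)$ ($EG_{LU}$ games) and $\mathsf{Energy}_{LU}(U,0)\cap\mathsf{AvgEnergy}(t)$ ($AE_{LU}$ games), with arbitrary energy upper bound $U\in\mathbb{N}$ and $t\in\mathbb{Q}$. For both kinds of objectives and for both players, pseudo-polynomial-memory strategies are both sufficient and necessary to win: a player who has a winning strategy has one with pseudo-polynomial memory; and for each player there are families of games won by that player, indexed by $U$, in which every winning strategy of that player requires memory polynomial in the value $U$ (hence not polynomial in the encoding size of the game). Moreover, polynomial memory suffices when $U$ is polynomial in the size of the game or encoded in unary.
   Context: A game is a tuple $G=(S_1,S_2,E,w)$ where $S_1,S_2$ are disjoint finite sets of states belonging to player 1 and player 2, $S=S_1\uplus S_2$, $E\subseteq S\times S$ is a finite set of edges such that every state has at least one outgoing edge, and $w\colon E\to\mathbb{Z}$ is an integer weight function. A play from $s_{\mathrm{init}}\in S$ is an infinite sequence $\pi=s_0s_1s_2\dots$ with $s_0=s_{\mathrm{init}}$ and $(s_i,s_{i+1})\in E$ for all $i\ge 0$; $\pi(n)=s_0\dots s_n$ is its prefix up to position $n$. A strategy for player $i$ is a function mapping each finite prefix ending in a state of $S_i$ to a successor (along an edge) of its last state; it is finite-memory if it can be encoded by a deterministic finite-state Moore machine, and its memory is measured by the number of states of that machine. Strategies of the two players and $s_{\mathrm{init}}$ determine a unique play, the outcome. The energy level is $\mathrm{EL}(\pi(n))=\sum_{i=0}^{n-1}w(s_i,s_{i+1})$, and the average-energy of $\pi$ is $\overline{AE}(\pi)=\limsup_{n\to\infty}\frac1n\sum_{i=1}^{n}\mathrm{EL}(\pi(i))$.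 $\mathsf{AvgEnergy}(t)$ is the set of plays $\pi$ with $\overline{AE}(\pi)\le t$. For $U,c\in\mathbb{N}$, $\mathsf{Energy}_{LU}(U,c)$ is the set of plays $\pi$ with $c+\mathrm{EL}(\pi(n))\in[0,U]$ for all $n\ge 0$. A strategy of player 1 is winning from $s_{\mathrm{init}}$ for an objective $\mathcal W$ (a set of plays) if, for every strategy of player 2, the outcome lies in $\mathcal W$; a strategy of player 2 is winning (against $\mathcal W$) if, for every strategy of player 1, the outcome does not lie in $\mathcal W$. Sizes of games are measured with weights, thresholds and (unless stated otherwise) $U$ encoded in binary. Pseudo-polynomial memory means a number of memory states bounded by a fixed polynomial in the number of states and edges of the game and in the values (not the encoding lengths) of the integers involved, in particular the value of $U$; polynomial memory means bounded by a fixed polynomial in the encoding size. "Requires memory polynomial in the value $U$" means: there is a constant $\epsilon>0$ such that, for all sufficiently large $U$, every winning strategy of the player in the game of index $U$ needs at least $U^{\epsilon}$ memory states, while the encoding size of that game is polynomial in $\log U$. -}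

module Defs where

open import Data.Bool.Base using (Bool; T)
open import Data.Bool.Properties using (T?)
open import Data.Fin.Base using (Fin)
open import Data.Integer.Base as ℤ using (ℤ; +_; 0ℤ; ∣_∣)
open import Data.List.Base as List using (List; allFin; cartesianProduct; foldr; length; map; mapMaybe)
open import Data.Maybe.Base as Maybe using (Maybe)
open import Data.Nat.Base as ℕ using (ℕ; zero; suc; NonZero; _⊔_)
open import Data.Nat.ListAction using (sum)
open import Data.Nat.Logarithm using (⌊log₂_⌋)
open import Data.Product.Base using (∃; _×_; _,_; proj₁; proj₂)
open import Data.Rational.Base as ℚ using (ℚ; 0ℚ; ↥_; ↧ₙ_)
open import Data.Unit.Base using (⊤)
open import Data.Vec.Base as Vec using (Vec; []; _∷_; lookup)
open import Relation.Binary.PropositionalEquality.Core using (_≡_; refl)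
open import Relation.Nullary.Decidable.Core using (dec⇒maybe)
open import Relation.Nullary.Negation.Core using (¬_)

-- As polynomials only serve as upper bounds on natural numbers, negative
-- coefficients would add nothing.

infixl 6 _⊕_
infixl 7 _⊗_

data Polynomial (k : ℕ) : Set where
  con     : ℕ → Polynomial k
  var     : Fin k → Polynomial k
  _⊕_ _⊗_ : Polynomial k → Polynomial k → Polynomial k

eval : ∀ {k} → Polynomial k → Vec ℕ k → ℕ
eval (con c) ρ = c
eval (var x) ρ = lookup ρ x
eval (p ⊕ q) ρ = eval p ρ ℕ.+ eval q ρ
eval (p ⊗ q) ρ = eval p ρ ℕ.* eval q ρ

eval₁ : Polynomial 1 → ℕ → ℕ
eval₁ p x = eval p (x ∷ [])

data Player : Set where
  player₁ player₂ : Player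

-- The partition S = S₁ ⊎ S₂ is given by the owner of each state.
record Game : Set where
  field
    #states : ℕ

  State : Set
  State = Fin #states

  field
    owner : State → Player
    edge  : State → State → Bool

  Edge : State → State → Set
  Edge s s′ = T (edge s s′)

  field
    weight : ∀ s s′ → Edge s s′ → ℤ
    total  : ∀ s → ∃ (Edge s)

  edgeWeights : List ℤ
  edgeWeights = mapMaybe weight? (cartesianProduct (allFin #states) (allFin #states))
    where
    weight? : State × State → Maybe ℤ
    weight? (s , s′) = Maybe.map (weight s s′) (dec⇒maybe (T? (edge s s′)))

  #edges : ℕ
  #edges = length edgeWeights

  maxWeight : ℕ
  maxWeight = foldr _⊔_ 0 (map ∣_∣ edgeWeights)

module _ (G : Game) where
  open Game G

  record Play : Set where
    field
      state : ℕ → State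
      edgeAt : ∀ n → Edge (state n) (state (suc n))

  -- Path s₀ s: the finite prefixes of plays from s₀ that end in s.
  infixl 5 _▷_

  data Path (s₀ : State) : State → Set where
    start : Path s₀ s₀
    _▷_   : ∀ {s s′} → Path s₀ s → Edge s s′ → Path s₀ s′

  Strategy : Player → Set
  Strategy i = ∀ {s₀ s} → Path s₀ s → owner s ≡ i → ∃ (Edge s)

module _ {G : Game} where
  open Game G

  module _ (σ₁ : Strategy G player₁) (σ₂ : Strategy G player₂) where

    move : ∀ {s₀ s} → Path G s₀ s → ∃ (Edge s)
    move {s = s} p = choose (owner s) refl
      where
      choose : ∀ i → owner s ≡ i → ∃ (Edge s)
      choose player₁ eq = σ₁ p eq
      choose player₂ eq = σ₂ p eq

    history : ∀ s₀ → ℕ → ∃ (Path G s₀)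
    history s₀ zero    = s₀ , start
    history s₀ (suc n) =
      let _ , p  = history s₀ n
          s′ , e = move p
      in  s′ , p ▷ e

    outcome : State → Play G
    outcome s₀ = record
      { state  = λ n → proj₁ (history s₀ n)
      ; edgeAt = λ n → proj₂ (move (proj₂ (history s₀ n)))
      }

  Objective : Set₁
  Objective = Play G → Set

  Winning : Objective → State → (i : Player) → Strategy G i → Set
  Winning W s₀ player₁ σ₁ = ∀ (σ₂ : Strategy G player₂) → W (outcome σ₁ σ₂ s₀)
  Winning W s₀ player₂ σ₂ = ∀ (σ₁ : Strategy G player₁) → ¬ W (outcome σ₁ σ₂ s₀)

  module _ (π : Play G) where
    open Play π

    -- EL n is the energy level of the prefix π(n).
    EL : ℕ → ℤ
    EL zero    = 0ℤ
    EL (suc n) = EL n ℤ.+ weight (state n) (state (suc n)) (edgeAt n)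

    -- sumEL n = EL 1 + ⋯ + EL n
    sumEL : ℕ → ℤ
    sumEL zero    = 0ℤ
    sumEL (suc n) = sumEL n ℤ.+ EL (suc n)

    averageEL : ∀ n .{{_ : NonZero n}} → ℚ
    averageEL n = sumEL n ℚ./ n

  -- limsup x ≤ t, for a sequence x indexed by the positive naturals
  LimSup≤ : (∀ n .{{_ : NonZero n}} → ℚ) → ℚ → Set
  LimSup≤ x t = ∀ ε → 0ℚ ℚ.< ε →
    ∃ λ N → ∀ n .{{_ : NonZero n}} → N ℕ.≤ n → x n ℚ.≤ t ℚ.+ ε

  AvgEnergy : ℚ → Objective
  AvgEnergy t π = LimSup≤ (averageEL π) t

  EnergyLU : (U c : ℕ) → Objective
  EnergyLU U c π = ∀ n → (0ℤ ℤ.≤ + c ℤ.+ EL π n) × (+ c ℤ.+ EL π n ℤ.≤ + U)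

-- A machine with m memory states.  The memory is updated with a state of
-- the game when that state is left; the next move depends on the memory
-- and the current state.
record Moore (G : Game) (i : Player) (m : ℕ) : Set where
  open Game G
  field
    init   : Fin m
    update : Fin m → State → Fin m
    next   : Fin m → ∀ s → owner s ≡ i → ∃ (Edge s)

  run : ∀ {s₀ s} → Path G s₀ s → Fin m
  run start             = init
  run (_▷_ {s = s} p _) = update (run p) s

  strategy : Strategy G i
  strategy {s = s} p = next (run p) s

data Kind : Set where
  EG AE : Kind

Threshold : Kind → Set
Threshold EG = ⊤
Threshold AE = ℚ

record Instance (k : Kind) : Set where
  field
    game      : Game
    initial   : Game.State game
    upper     : ℕ
    threshold : Threshold k

open Instance public using (upper)

objective : ∀ {k} (I : Instance k) → Objective {Instance.game I}
objective {EG} I π = EnergyLU (upper I) 0 π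
objective {AE} I π = EnergyLU (upper I) 0 π × AvgEnergy (Instance.threshold I) π

module _ {k : Kind} (i : Player) (I : Instance k) where
  open Instance I using (game; initial)

  WinningStrategy : Strategy game i → Set
  WinningStrategy = Winning (objective I) initial i

  Wins : Set
  Wins = ∃ λ (σ : Strategy game i) → WinningStrategy σ

  WinningMachine : ℕ → Set
  WinningMachine m = ∃ λ (M : Moore game i m) → WinningStrategy (Moore.strategy M)

  WinsWithMemory : ℕ → Set
  WinsWithMemory b = ∃ λ m → m ℕ.≤ b × WinningMachine m

#thresholdValues : Kind → ℕ
#thresholdValues EG = 0
#thresholdValues AE = 2

thresholdValues : ∀ k → Threshold k → Vec ℕ (#thresholdValues k)
thresholdValues EG _ = []
thresholdValues AE t = ∣ ↥ t ∣ ∷ ↧ₙ t ∷ []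

-- The quantities in which pseudo-polynomial bounds are polynomial.
#values : Kind → ℕ
#values k = 4 ℕ.+ #thresholdValues k

values : ∀ {k} → Instance k → Vec ℕ (#values k)
values {k} I = #states ∷ #edges ∷ maxWeight ∷ upper I ∷ thresholdValues k threshold
  where
  open Instance I
  open Game game

-- The number of binary digits of n, with 0 written as one digit.
bits : ℕ → ℕ
bits n = suc ⌊log₂ n ⌋

-- One extra bit for the sign.
bitsℤ : ℤ → ℕ
bitsℤ z = suc (bits ∣ z ∣)

-- One bit of ownership per state; endpoints and weight for each edge.
gameSize : Game → ℕ
gameSize G = #states ℕ.+ sum (map edgeSize edgeWeights)
  where
  open Game G
  edgeSize : ℤ → ℕ
  edgeSize w = bits #states ℕ.+ bits #states ℕ.+ bitsℤ w

thresholdSize : ∀ k → Threshold k → ℕ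
thresholdSize EG _ = 0
thresholdSize AE t = bitsℤ (↥ t) ℕ.+ bits (↧ₙ t)

module _ {k : Kind} (I : Instance k) where
  open Instance I using (game; threshold)

  size : ℕ
  size = gameSize game ℕ.+ thresholdSize k threshold ℕ.+ bits (upper I)

  -- With the energy upper bound encoded in unary.
  unarySize : ℕ
  unarySize = gameSize game ℕ.+ thresholdSize k threshold ℕ.+ upper I

{-# OPTIONS --safe #-}
module Submission where

open import Data.Bool.Base using (Bool; true; false; T)
open import Data.Bool.Properties using (T?; T-irrelevant)
open import Data.Empty using (⊥; ⊥-elim)
open import Data.Fin.Base using (Fin; zero; suc; toℕ; combine; remQuot; fromℕ<)
import Data.Fin.Properties as Fin
open import Data.Integer.Base as ℤ using (ℤ; +_; -[1+_]; 0ℤ; 1ℤ; ∣_∣)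
import Data.Integer.Properties as ℤ
open import Data.Integer.Tactic.RingSolver using (solve-∀)
open import Data.Nat.Base
import Data.Nat.Coprimality as Coprimality
open import Data.Nat.Divisibility using (_∣_; _∣?_; divides; ∣⇒≤; ∣m+n∣m⇒∣n)
open import Data.Nat.DivMod
open import Data.Nat.Logarithm using (⌊log₂_⌋; ⌊log₂[2^n]⌋≡n)
open import Data.Nat.Properties
import Data.Nat.Tactic.RingSolver as ℕ-Solver
open import Data.Product.Base using (Σ; ∃; ∃₂; _×_; _,_; proj₁; proj₂)
open import Data.Rational.Base as ℚ using (ℚ; mkℚ; 0ℚ; ↥_; ↧ₙ_; toℚᵘ; fromℚᵘ)
import Data.Rational.Properties as ℚ
open import Data.Rational.Unnormalised.Base as ℚᵘ using (mkℚᵘ)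
import Data.Rational.Unnormalised.Properties as ℚᵘ
open import Data.Sum.Base using (_⊎_; inj₁; inj₂)
open import Data.Unit.Base using (⊤; tt)
open import Data.Vec.Functional using (updateAt)
open import Data.Vec.Functional.Properties using (updateAt-updates; updateAt-minimal)
open import Function.Base using (_∘_; _∋_)
open import Relation.Binary.PropositionalEquality
open import Relation.Nullary
open import Relation.Nullary.Decidable using (¬?; _×-dec_; _⊎-dec_; _→-dec_; map′)
open import Defs

-- Sufficiency.  Reading the energy levels as rewards turns the average-energy
-- objective with lower and upper bound into a mean-payoff objective on the finite
-- graph of pairs (state, level); EG is the case of the threshold U.  For integer
-- rewards r and K larger than the number n of pairs, put r̂ = K r - 1, and let x
-- be a fixed point of value iteration for the total r̂-payoff, clamped to a long
-- interval [0, H].  By the pigeonhole principle some window of width at least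
-- max ∣r̂∣ in that interval contains no value of x; values cannot jump over it, so
-- that the pairs below and above it are positionally closed for player 1 and 2.
-- Below, x bounds the sums of K r - 1 from above; again by the pigeonhole
-- principle, rounding x to multiples of K at a suitable offset absorbs the defect
-- -1 and bounds the sums of r.  Above, the sums of K r - 1 are bounded from below,
-- whence the mean of r is at least 1 / K > 0.  A positional strategy on pairs only
-- has to remember the energy level; no bound depends on weights or thresholds.
--
-- Necessity.  A player who has to recognise the moment at which the energy,
-- raised in steps of 1 from 0, equals U must count up to U.

-- Integer arithmetic

-- Linear arithmetic becomes a ring identity, which the ring solver proves.
≤-by : ∀ {a b A B} → a ℤ.≤ b → A ℤ.+ b ≡ B ℤ.+ a → A ℤ.≤ B
≤-by {a} {b} {A} {B} a≤b eq = ℤ.i-j≤0⇒i≤j (subst (ℤ._≤ 0ℤ) difference (ℤ.i≤j⇒i-j≤0 a≤b))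
  where
  shift : ∀ a b B → a ℤ.- b ≡ B ℤ.+ a ℤ.- (B ℤ.+ b)
  shift = solve-∀
  unshift : ∀ A B b → A ℤ.+ b ℤ.- (B ℤ.+ b) ≡ A ℤ.- B
  unshift = solve-∀
  difference : a ℤ.- b ≡ A ℤ.- B
  difference = trans (shift a b B) (trans (cong (ℤ._- (B ℤ.+ b)) (sym eq)) (unshift A B b))

i≤∣i∣ : ∀ i → i ℤ.≤ + ∣ i ∣
i≤∣i∣ (+ n)    = ℤ.≤-refl
i≤∣i∣ -[1+ n ] = ℤ.-≤+

-i≤∣i∣ : ∀ i → ℤ.- i ℤ.≤ + ∣ i ∣
-i≤∣i∣ i = subst (λ m → ℤ.- i ℤ.≤ + m) (ℤ.∣-i∣≡∣i∣ i) (i≤∣i∣ (ℤ.- i))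

≤-∣∣ʳ : ∀ {m n i} → + m ℤ.≤ + n ℤ.+ i → m ≤ n + ∣ i ∣
≤-∣∣ʳ {n = n} {i} m≤ = ℤ.drop‿+≤+ (ℤ.≤-trans m≤ (ℤ.+-monoʳ-≤ (+ n) (i≤∣i∣ i)))

≤-∣∣ˡ : ∀ {m n i} → + m ℤ.+ i ℤ.≤ + n → m ≤ n + ∣ i ∣
≤-∣∣ˡ {m} {n} {i} ≤n = ℤ.drop‿+≤+ (≤-by (ℤ.+-mono-≤ ≤n (-i≤∣i∣ i)) (rearrange (+ m) (+ n) i (+ ∣ i ∣)))
  where
  rearrange : ∀ m n i a → m ℤ.+ (n ℤ.+ a) ≡ n ℤ.+ a ℤ.+ (m ℤ.+ i ℤ.+ ℤ.- i)
  rearrange = solve-∀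

-- Rounding `x′ + e` down to a multiple of `K` loses at least 1, since `K` does not divide it; this
-- pays for the defect -1 of the step.
floor-step : ∀ K .{{_ : NonZero K}} {x x′} e {r} → ¬ K ∣ x′ + e →
             + x′ ℤ.+ (+ K ℤ.* r ℤ.- 1ℤ) ℤ.≤ + x →
             r ℤ.+ + ((x′ + e) / K) ℤ.≤ + ((x + e) / K)
floor-step K@(suc _) {x} {x′} e {r} K∤ step =
  ≤-by (ℤ.i<j⇒suc[i]≤j (ℤ.*-cancelʳ-<-nonNeg {r ℤ.+ + q′} {1ℤ ℤ.+ + q} (+ K) (ℤ.suc[i]≤j⇒i<j bound)))
    (shift r (+ q) (+ q′))
  where
  q = (x + e) / K
  q′ = (x′ + e) / K
  shift : ∀ r q q′ → r ℤ.+ q′ ℤ.+ (1ℤ ℤ.+ q) ≡ q ℤ.+ (1ℤ ℤ.+ (r ℤ.+ q′))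
  shift = solve-∀
  below : q′ * K < x′ + e
  below = ≤∧≢⇒< (m/n*n≤m (x′ + e) K) (λ eq → K∤ (divides q′ (sym eq)))
  above : x + e < K + q * K
  above = subst (_< K + q * K) (sym (m≡m%n+[m/n]*n (x + e) K))
    (+-monoˡ-< (q * K) (m%n<n (x + e) K))
  below′ : 1ℤ ℤ.+ + q′ ℤ.* + K ℤ.≤ + x′ ℤ.+ + e
  below′ = subst (λ i → 1ℤ ℤ.+ i ℤ.≤ _) (ℤ.pos-* q′ K) (ℤ.+≤+ below)
  above′ : 1ℤ ℤ.+ (+ x ℤ.+ + e) ℤ.≤ + K ℤ.+ + q ℤ.* + K
  above′ = subst (λ i → _ ℤ.≤ + K ℤ.+ i) (ℤ.pos-* q K) (ℤ.+≤+ above)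
  rearrange : ∀ K q q′ r x x′ e →
    1ℤ ℤ.+ (r ℤ.+ q′) ℤ.* K ℤ.+ (x′ ℤ.+ e ℤ.+ (x ℤ.+ (K ℤ.+ q ℤ.* K))) ≡
    (1ℤ ℤ.+ q) ℤ.* K ℤ.+ (1ℤ ℤ.+ q′ ℤ.* K ℤ.+ (x′ ℤ.+ (K ℤ.* r ℤ.- 1ℤ) ℤ.+ (1ℤ ℤ.+ (x ℤ.+ e))))
  rearrange = solve-∀
  bound : 1ℤ ℤ.+ (r ℤ.+ + q′) ℤ.* + K ℤ.≤ (1ℤ ℤ.+ + q) ℤ.* + K
  bound = ≤-by (ℤ.+-mono-≤ below′ (ℤ.+-mono-≤ step above′))
    (rearrange (+ K) (+ q) (+ q′) r (+ x) (+ x′) (+ e))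

-- Fixed points of clamped value iteration

sumᶠ : ∀ {n} → (Fin n → ℕ) → ℕ
sumᶠ {zero}  x = 0
sumᶠ {suc n} x = x zero + sumᶠ (x ∘ suc)

sumᶠ-updateAt : ∀ {n} (x : Fin n → ℕ) v → sumᶠ (updateAt x v suc) ≡ suc (sumᶠ x)
sumᶠ-updateAt x zero    = refl
sumᶠ-updateAt x (suc v) =
  trans (cong (λ m → x zero + m) (sumᶠ-updateAt (x ∘ suc) v)) (+-suc (x zero) _)

sumᶠ-bound : ∀ {n H} (x : Fin n → ℕ) → (∀ v → x v ≤ H) → sumᶠ x ≤ n * H
sumᶠ-bound {zero}  x x≤H = z≤n
sumᶠ-bound {suc n} x x≤H = +-mono-≤ (x≤H zero) (sumᶠ-bound (x ∘ suc) (x≤H ∘ suc))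

sumᶠ-upper : ∀ {n} (x : Fin n → ℕ) v → x v ≤ sumᶠ x
sumᶠ-upper x zero    = m≤m+n _ _
sumᶠ-upper x (suc v) = ≤-trans (sumᶠ-upper (x ∘ suc) v) (m≤n+m _ _)

-- `R x v k` reads: the labels `x` justify label `k` at `v`. By monotonicity, raising one entry
-- keeps the others justified, so that value iteration may proceed by single increments.
module Lifting
  {n : ℕ} (H : ℕ) (R : (Fin n → ℕ) → Fin n → ℕ → Set)
  (R? : ∀ x v k → Dec (R x v k))
  (R-mono : ∀ {x y v k} → (∀ u → x u ≤ y u) → R x v k → R y v k)
  where

  record Labelling (x : Fin n → ℕ) : Set where
    field
      bounded  : ∀ v → x v ≤ H
      grounded : ∀ v → 0 < x v → R x v (x v)

  Liftable : (Fin n → ℕ) → Fin n → Set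
  Liftable x v = x v < H × R x v (suc (x v))

  liftable? : ∀ x v → Dec (Liftable x v)
  liftable? x v = (x v <? H) ×-dec R? x v (suc (x v))

  lift : ∀ {x} v → Liftable x v → Labelling x → Labelling (updateAt x v suc)
  lift {x} v (x<H , r) lab = record { bounded = bounded′ ; grounded = grounded′ }
    where
    open Labelling lab
    x′ = updateAt x v suc

    x≤x′ : ∀ u → x u ≤ x′ u
    x≤x′ u with u Fin.≟ v
    ... | yes refl = ≤-trans (n≤1+n _) (≤-reflexive (sym (updateAt-updates v x)))
    ... | no  u≢v  = ≤-reflexive (sym (updateAt-minimal u v x u≢v))

    bounded′ : ∀ u → x′ u ≤ H
    bounded′ u with u Fin.≟ v
    ... | yes refl = subst (_≤ H) (sym (updateAt-updates v x)) x<H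
    ... | no  u≢v  = subst (_≤ H) (sym (updateAt-minimal u v x u≢v)) (bounded u)

    grounded′ : ∀ u → 0 < x′ u → R x′ u (x′ u)
    grounded′ u 0<x′ with u Fin.≟ v
    ... | yes refl = subst (R x′ u) (sym (updateAt-updates v x)) (R-mono x≤x′ r)
    ... | no  u≢v  = subst (R x′ u) (sym eq) (R-mono x≤x′ (grounded u (subst (0 <_) eq 0<x′)))
      where eq = updateAt-minimal u v x u≢v

  -- Every lift raises `sumᶠ x` by one, and this sum never exceeds `n * H`; hence the fuel lasts
  -- until no lift is possible.
  saturate : ∀ fuel {x} → n * H ≤ fuel + sumᶠ x → Labelling x →
             ∃ λ y → Labelling y × (∀ v → ¬ Liftable y v)
  saturate fuel {x} n*H≤ lab with Fin.any? (liftable? x)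
  ... | no  stable = x , lab , λ v l → stable (v , l)
  saturate zero {x} n*H≤ lab | yes (v , l) =
    ⊥-elim (<⇒≱ (≤-reflexive (sym (sumᶠ-updateAt x v)))
      (≤-trans (sumᶠ-bound _ (Labelling.bounded (lift v l lab))) n*H≤))
  saturate (suc fuel) {x} n*H≤ lab | yes (v , l) =
    saturate fuel (subst (n * H ≤_) eq n*H≤) (lift v l lab)
    where
    eq : suc fuel + sumᶠ x ≡ fuel + sumᶠ (updateAt x v suc)
    eq = sym (trans (cong (λ m → fuel + m) (sumᶠ-updateAt x v)) (+-suc fuel _))

  stableLabelling : ∃ λ x → Labelling x × (∀ v → ¬ Liftable x v)
  stableLabelling = saturate (n * H) {λ _ → 0} (m≤m+n _ _)
    (record { bounded = λ _ → z≤n ; grounded = λ _ () })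

-- If each of the `suc n` places had an occupant, two of them would share one, against
-- functionality.
unoccupied : ∀ {n} (R : Fin n → Fin (suc n) → Set) → (∀ v j → Dec (R v j)) →
             (∀ v {i j} → R v i → R v j → i ≡ j) →
             ∃ λ j → ∀ v → ¬ R v j
unoccupied R R? functional with Fin.any? (λ j → Fin.all? (λ v → ¬? (R? v j)))
... | yes found = found
... | no  full  = ⊥-elim (clash (Fin.pigeonhole (n<1+n _) (proj₁ ∘ occupant)))
  where
  occupant : ∀ j → ∃ λ v → R v j
  occupant j with Fin.any? (λ v → R? v j)
  ... | yes found = found
  ... | no  none  = ⊥-elim (full (j , λ v r → none (v , r)))

  clash : ¬ ∃₂ λ i j → toℕ i < toℕ j × proj₁ (occupant i) ≡ proj₁ (occupant j)
  clash (i , j , i<j , eq) = <⇒≢ i<j (cong toℕ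
    (functional _ (subst (λ v → R v i) eq (proj₂ (occupant i))) (proj₂ (occupant j))))

-- Positional determinacy on states with energy levels

opponent : Player → Player
opponent player₁ = player₂
opponent player₂ = player₁

_≟ₚ_ : (i j : Player) → Dec (i ≡ j)
player₁ ≟ₚ player₁ = yes refl
player₁ ≟ₚ player₂ = no λ ()
player₂ ≟ₚ player₁ = no λ ()
player₂ ≟ₚ player₂ = yes refl

module Forcing (G : Game) where
  open Game G

  -- The controllable-predecessor operator for a single move from `s`.
  Forces : Player → ∀ s → (∀ s′ → Edge s s′ → Set) → Set
  Forces i s P = (owner s ≡ i × ∃₂ P) ⊎ (owner s ≡ opponent i × ∀ s′ e → P s′ e)

  forces-map : ∀ {i s} {P Q : ∀ s′ → Edge s s′ → Set} →
               (∀ s′ e → P s′ e → Q s′ e) → Forces i s P → Forces i s Q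
  forces-map f (inj₁ (own , s′ , e , p)) = inj₁ (own , s′ , e , f s′ e p)
  forces-map f (inj₂ (opp , ps))         = inj₂ (opp , λ s′ e → f s′ e (ps s′ e))

  someT? : ∀ b {P : T b → Set} → (∀ e → Dec (P e)) → Dec (∃ P)
  someT? true  P? = map′ (tt ,_) proj₂ (P? tt)
  someT? false P? = no proj₁

  allT? : ∀ b {P : T b → Set} → (∀ e → Dec (P e)) → Dec (∀ e → P e)
  allT? true  P? = map′ (λ p _ → p) (λ p → p tt) (P? tt)
  allT? false P? = yes λ ()

  module _ {s} {P : ∀ s′ → Edge s s′ → Set} (P? : ∀ s′ e → Dec (P s′ e)) where

    someMove? : Dec (∃₂ P)
    someMove? = Fin.any? λ s′ → someT? (edge s s′) (P? s′)

    forces? : ∀ i → Dec (Forces i s P)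
    forces? i = ((owner s ≟ₚ i) ×-dec someMove?) ⊎-dec
      ((owner s ≟ₚ opponent i) ×-dec Fin.all? λ s′ → allT? (edge s s′) (P? s′))

    -- Determinacy of a single move. Finiteness and decidability of `P` turn a negated universal
    -- into a move of player 1.
    ¬forces₂⇒forces₁ : ¬ Forces player₂ s P → Forces player₁ s (λ s′ e → ¬ P s′ e)
    ¬forces₂⇒forces₁ ¬f with owner s
    ... | player₂ = inj₂ (refl , λ s′ e p → ¬f (inj₁ (refl , s′ , e , p)))
    ... | player₁ = inj₁ (refl , escape)
      where
      escape : ∃₂ λ s′ e → ¬ P s′ e
      escape with Fin.any? (λ s′ → someT? (edge s s′) (λ e → ¬? (P? s′ e)))
      ... | yes found = found
      ... | no  none  = ⊥-elim (¬f (inj₂ (refl , λ s′ e →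
        decidable-stable (P? s′ e) (λ ¬p → none (s′ , e , ¬p)))))

-- Every value in the window of width `D` that starts at `suc j * D` has quotient `suc j`.
gap : ∀ {x D} j .{{_ : NonZero D}} → x / D ≢ suc j → x < D + suc j * D → x < suc j * D
gap {x} {D} j x/D≢ x< with x <? suc j * D
... | yes x<θ = x<θ
... | no  x≮θ = ⊥-elim (x/D≢ (≤-antisym (s≤s⁻¹ (m<n*o⇒m/o<n {n = 2 + j} x<))
  (subst (_≤ x / D) (m*n/n≡m (suc j) D) (/-monoˡ-≤ D (≮⇒≥ x≮θ)))))

residue-unique : ∀ {K x i j} → K ∣ x + i → K ∣ x + j → i < K → j < K → i ≡ j
residue-unique {K} {x} p q i<K j<K = ≤-antisym (residue≤ q p i<K) (residue≤ p q j<K)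
  where
  residue≤ : ∀ {i j} → K ∣ x + i → K ∣ x + j → j < K → j ≤ i
  residue≤ {i} {j} p q j<K with j ≤? i
  ... | yes j≤i = j≤i
  ... | no  j≰i = ⊥-elim (<⇒≱ (≤-<-trans (m∸n≤m j i) j<K)
    (∣⇒≤ {{>-nonZero (m<n⇒0<n∸m i<j)}} (∣m+n∣m⇒∣n (subst (K ∣_) split q) p)))
    where
    i<j = ≰⇒> j≰i
    split : x + j ≡ x + i + (j ∸ i)
    split = trans (cong (λ m → x + m) (sym (m+[n∸m]≡n (<⇒≤ i<j)))) (sym (+-assoc x i (j ∸ i)))

-- A relation and not a function, as `w` may lead out of the interval [0, U]; then no `c′` is
-- related to `c`.
Next : ∀ {U} → Fin (suc U) → ℤ → Fin (suc U) → Set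
Next c w c′ = + toℕ c′ ≡ + toℕ c ℤ.+ w

next? : ∀ {U} (c : Fin (suc U)) w c′ → Dec (Next c w c′)
next? c w c′ = + toℕ c′ ℤ.≟ + toℕ c ℤ.+ w

module Determinacy (G : Game) (U : ℕ) (r : Fin (suc U) → ℤ) where
  open Game G
  open Forcing G

  Level : Set
  Level = Fin (suc U)

  -- A region in which player 1 keeps the energy in bounds, with a potential that pays for every
  -- reward: the sums of `r` never exceed the initial potential.
  record Certificate₁ (s₀ : State) (c₀ : Level) : Set₁ where
    field
      Good      : State → Level → Set
      good?     : ∀ s c → Dec (Good s c)
      initial   : Good s₀ c₀
      potential : State → Level → ℕ
      progress  : ∀ s c → Good s c → Forces player₁ s λ s′ e → ∃ λ c′ →
        Next c (weight s s′ e) c′ × Good s′ c′ ×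
        r c′ ℤ.+ + potential s′ c′ ℤ.≤ + potential s c

  -- Only moves that stay in bounds matter here, because leaving the bounds is a win for player 2.
  -- The bounded potential keeps the sums of `suc factor * r - 1` bounded from below.
  record Certificate₂ (s₀ : State) (c₀ : Level) : Set₁ where
    field
      Good      : State → Level → Set
      good?     : ∀ s c → Dec (Good s c)
      initial   : Good s₀ c₀
      potential : State → Level → ℕ
      bound     : ℕ
      bounded   : ∀ s c → potential s c ≤ bound
      factor    : ℕ
      progress  : ∀ s c → Good s c → Forces player₂ s λ s′ e → ∀ c′ →
        Next c (weight s s′ e) c′ → Good s′ c′ ×
        + potential s c ℤ.≤ + potential s′ c′ ℤ.+ (+ suc factor ℤ.* r c′ ℤ.- 1ℤ)

  scaled : ℕ → Level → ℤ
  scaled K c = + K ℤ.* r c ℤ.- 1ℤ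

  -- The quantifier over `c′` lets a move out of bounds satisfy `Loss` for every `k`, as if it gave
  -- player 2 an infinite payoff.
  Loss : ℕ → (State → Level → ℕ) → ℕ → ∀ s → Level → ∀ s′ → Edge s s′ → Set
  Loss K x k s c s′ e = ∀ c′ → Next c (weight s s′ e) c′ → + k ℤ.≤ + x s′ c′ ℤ.+ scaled K c′

  loss-step? : ∀ K (x : State → Level → ℕ) k s c s′ e c′ →
    Dec (Next c (weight s s′ e) c′ → + k ℤ.≤ + x s′ c′ ℤ.+ scaled K c′)
  loss-step? K x k s c s′ e c′ = next? c (weight s s′ e) c′ →-dec (+ k ℤ.≤? + x s′ c′ ℤ.+ scaled K c′)

  loss? : ∀ K (x : State → Level → ℕ) k s c s′ e → Dec (Loss K x k s c s′ e)
  loss? K x k s c s′ e = Fin.all? (loss-step? K x k s c s′ e)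

  -- What the certificates need of the stable labelling: no label lies in the window from `θ` to
  -- `D + θ`, no scaled reward exceeds its width `D` in absolute value, and `residue` is a suitable
  -- offset for rounding.
  record Separation : Set where
    field
      factor residue D θ height : ℕ
      label       : State → Level → ℕ
      label≤      : ∀ s c → label s c ≤ height
      θ≤          : θ ≤ height
      θ>0         : 0 < θ
      label-gap   : ∀ s c → label s c < D + θ → label s c < θ
      small       : ∀ c → ∣ scaled (suc factor) c ∣ ≤ D
      indivisible : ∀ s c → ¬ suc factor ∣ label s c + residue
      maximal     : ∀ s c → label s c < height →
        ¬ Forces player₂ s (Loss (suc factor) label (suc (label s c)) s c)
      supported   : ∀ s c → 0 < label s c →
        Forces player₂ s (Loss (suc factor) label (label s c) s c)

  separation : Separation
  separation = record
    { factor      = N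
    ; residue     = toℕ (proj₁ freeResidue)
    ; D           = D
    ; θ           = suc (toℕ (proj₁ freeInterval)) * D
    ; height      = H
    ; label       = at x
    ; label≤      = λ s c → bounded (combine s c)
    ; θ≤          = *-monoˡ-≤ D (≤-trans (Fin.toℕ<n (proj₁ freeInterval)) (n≤1+n _))
    ; θ>0         = s≤s z≤n
    ; label-gap   = λ s c → gap (toℕ (proj₁ freeInterval)) (proj₂ freeInterval (combine s c))
    ; small       = λ c → ≤-trans (sumᶠ-upper (∣_∣ ∘ scaled K) c) (n≤1+n _)
    ; indivisible = λ s c → proj₂ freeResidue (combine s c)
    ; maximal     = λ s c x<H f → noLift (combine s c)
        (x<H , subst (λ p → R′ x p (suc (at x s c))) (sym (Fin.remQuot-combine s c)) f)
    ; supported   = λ s c 0<x → subst (λ p → R′ x p (at x s c)) (Fin.remQuot-combine s c)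
        (grounded (combine s c) 0<x)
    }
    where
    -- There are `N` labels. Hence one of the `K = N + 1` residues is free, and so is one of the
    -- `N + 1` windows of width `D` between `D` and `H`. The window below `D` is left out to make
    -- `θ` positive.
    N K D H : ℕ
    N = #states * suc U
    K = suc N
    D = suc (sumᶠ (∣_∣ ∘ scaled K))
    H = (2 + N) * D

    at : (Fin N → ℕ) → State → Level → ℕ
    at x s c = x (combine s c)

    R′ : (Fin N → ℕ) → State × Level → ℕ → Set
    R′ x (s , c) k = Forces player₂ s (Loss K (at x) k s c)

    R : (Fin N → ℕ) → Fin N → ℕ → Set
    R x v = R′ x (remQuot (suc U) v)

    R? : ∀ x v k → Dec (R x v k)
    R? x v k = forces? (loss? K (at x) k _ _) player₂

    R-mono : ∀ {x y v k} → (∀ u → x u ≤ y u) → R x v k → R y v k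
    R-mono x≤y = forces-map λ s′ e loss c′ nxt →
      ℤ.≤-trans (loss c′ nxt) (ℤ.+-monoˡ-≤ (scaled K c′) (ℤ.+≤+ (x≤y (combine s′ c′))))

    open Lifting H R R? R-mono

    x = proj₁ stableLabelling
    open Labelling (proj₁ (proj₂ stableLabelling))
    noLift = proj₂ (proj₂ stableLabelling)

    freeInterval : ∃ λ (j : Fin (suc N)) → ∀ v → x v / D ≢ suc (toℕ j)
    freeInterval = unoccupied _ (λ v j → x v / D ≟ suc (toℕ j))
      (λ v eq eq′ → Fin.toℕ-injective (suc-injective (trans (sym eq) eq′)))

    freeResidue : ∃ λ (e : Fin K) → ∀ v → ¬ K ∣ x v + toℕ e
    freeResidue = unoccupied _ (λ v e → K ∣? x v + toℕ e)
      (λ v {i} {j} p q → Fin.toℕ-injective (residue-unique p q (Fin.toℕ<n i) (Fin.toℕ<n j)))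

  module _ (S : Separation) where
    open Separation S

    -- Below `θ` no label has reached `height`, so that stability applies: player 2 cannot force the
    -- next larger label, hence player 1 can prevent it.
    certificate₁ : ∀ {s₀ c₀} → label s₀ c₀ < θ → Certificate₁ s₀ c₀
    certificate₁ x₀<θ = record
      { Good      = λ s c → label s c < θ
      ; good?     = λ s c → label s c <? θ
      ; initial   = x₀<θ
      ; potential = λ s c → (label s c + residue) / suc factor
      ; progress  = λ s c x<θ → forces-map (decrease s c x<θ)
          (¬forces₂⇒forces₁ (loss? (suc factor) label (suc (label s c)) s c)
            (maximal s c (<-≤-trans x<θ θ≤)))
      }
      where
      decrease : ∀ s c → label s c < θ → ∀ s′ e →
        ¬ Loss (suc factor) label (suc (label s c)) s c s′ e → ∃ λ c′ →
        Next c (weight s s′ e) c′ × label s′ c′ < θ ×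
        r c′ ℤ.+ + ((label s′ c′ + residue) / suc factor) ℤ.≤ + ((label s c + residue) / suc factor)
      decrease s c x<θ s′ e ¬loss
        with c′ , ¬step ← Fin.¬∀⟶∃¬ _ _ (loss-step? (suc factor) label (suc (label s c)) s c s′ e) ¬loss
        with next? c (weight s s′ e) c′
      ... | no  ¬nxt = ⊥-elim (¬step (⊥-elim ∘ ¬nxt))
      ... | yes nxt  = c′ , nxt
        -- One scaled reward raises the label by at most `D`, which does not lead across the window.
        , label-gap _ _ (≤-<-trans (≤-∣∣ˡ {i = scaled (suc factor) c′} down)
            (subst (_< D + θ) (+-comm _ (label s c)) (+-mono-≤-< (small c′) x<θ)))
        , floor-step (suc factor) residue {r c′} (indivisible s′ c′) down
        where
        down : + label s′ c′ ℤ.+ scaled (suc factor) c′ ℤ.≤ + label s c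
        down = ℤ.i<j⇒i≤pred[j] (ℤ.≰⇒> (λ le → ¬step (λ _ → le)))

    -- Labels from `θ` on are positive and hence supported. The support cannot come from below the
    -- window, which is too wide for one scaled reward.
    certificate₂ : ∀ {s₀ c₀} → ¬ label s₀ c₀ < θ → Certificate₂ s₀ c₀
    certificate₂ x₀≮θ = record
      { Good      = λ s c → ¬ label s c < θ
      ; good?     = λ s c → ¬? (label s c <? θ)
      ; initial   = x₀≮θ
      ; potential = label
      ; bound     = height
      ; bounded   = label≤
      ; factor    = factor
      ; progress  = λ s c x≮θ → forces-map (increase s c x≮θ)
          (supported s c (<-≤-trans θ>0 (≮⇒≥ x≮θ)))
      }
      where
      increase : ∀ s c → ¬ label s c < θ → ∀ s′ e →
        Loss (suc factor) label (label s c) s c s′ e → ∀ c′ → Next c (weight s s′ e) c′ →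
        ¬ label s′ c′ < θ × + label s c ℤ.≤ + label s′ c′ ℤ.+ scaled (suc factor) c′
      increase s c x≮θ s′ e loss c′ nxt = stay , loss c′ nxt
        where
        stay : ¬ label s′ c′ < θ
        stay x′<θ = x≮θ (label-gap _ _ (≤-<-trans
          (≤-∣∣ʳ {n = label s′ c′} {scaled (suc factor) c′} (loss c′ nxt))
          (subst (_< D + θ) (+-comm _ (label s′ c′)) (+-mono-≤-< (small c′) x′<θ))))

    certify : ∀ s c → Certificate₁ s c ⊎ Certificate₂ s c
    certify s c with label s c <? θ
    ... | yes x<θ = inj₁ (certificate₁ x<θ)
    ... | no  x≮θ = inj₂ (certificate₂ x≮θ)

  determined : ∀ s c → Certificate₁ s c ⊎ Certificate₂ s c
  determined = certify separation

-- Averages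

-- Division by `b * n` leaves an error of at most `C / n`, and `ε` is at least one over its
-- denominator `d`; hence `C * d` is far enough.
limSup≤ : ∀ {G} (S : ℕ → ℤ) (t : ℚ) (C : ℕ) →
  (∀ n → + ↧ₙ t ℤ.* S n ℤ.≤ ↥ t ℤ.* + n ℤ.+ + C) →
  LimSup≤ {G} (λ n → S n ℚ./ n) t
limSup≤ {G} S t@(mkℚ a b-1 _) C bound ε@(mkℚ e d-1 _) 0<ε = C * suc d-1 , average
  where
  b d : ℤ
  b = + suc b-1
  d = + suc d-1

  0<e : 1ℤ ℤ.≤ e
  0<e = ℤ.i<j⇒suc[i]≤j (subst₂ ℤ._<_ (ℤ.*-zeroˡ d) (ℤ.*-identityʳ e) (ℚ.drop-*<* 0<ε))

  average : ∀ n .{{_ : NonZero n}} → C * suc d-1 ≤ n → S n ℚ./ n ℚ.≤ t ℚ.+ ε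
  average n@(suc n-1) C*d≤n = ℚ.toℚᵘ-cancel-≤
    (ℚᵘ.≤-respˡ-≃ (ℚᵘ.≃-sym (ℚ.toℚᵘ-fromℚᵘ (mkℚᵘ (S n) n-1)))
      (ℚᵘ.≤-respʳ-≃ (ℚᵘ.≃-sym (ℚ.toℚᵘ-homo-+ t ε)) (ℚᵘ.*≤* cross)))
    where
    scaledBound : b ℤ.* S n ℤ.* d ℤ.≤ (a ℤ.* + n ℤ.+ + C) ℤ.* d
    scaledBound = ℤ.*-monoʳ-≤-nonNeg d (bound n)

    C*d≤n′ : + C ℤ.* d ℤ.≤ + n
    C*d≤n′ = subst (ℤ._≤ + n) (ℤ.pos-* C _) (ℤ.+≤+ C*d≤n)

    1≤e*b : 1ℤ ℤ.≤ e ℤ.* b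
    1≤e*b = ℤ.≤-trans (ℤ.+≤+ (s≤s z≤n))
      (subst (ℤ._≤ e ℤ.* b) (ℤ.*-identityˡ b) (ℤ.*-monoʳ-≤-nonNeg b 0<e))

    n≤e*b*n : + n ℤ.≤ e ℤ.* b ℤ.* + n
    n≤e*b*n = subst (ℤ._≤ e ℤ.* b ℤ.* + n) (ℤ.*-identityˡ (+ n)) (ℤ.*-monoʳ-≤-nonNeg (+ n) 1≤e*b)

    rearrange : ∀ S a b C d e n →
      S ℤ.* (b ℤ.* d) ℤ.+ ((a ℤ.* n ℤ.+ C) ℤ.* d ℤ.+ (n ℤ.+ e ℤ.* b ℤ.* n)) ≡
      (a ℤ.* d ℤ.+ e ℤ.* b) ℤ.* n ℤ.+ (b ℤ.* S ℤ.* d ℤ.+ (C ℤ.* d ℤ.+ n))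
    rearrange = solve-∀

    cross : S n ℤ.* (b ℤ.* d) ℤ.≤ (a ℤ.* d ℤ.+ e ℤ.* b) ℤ.* + n
    cross = ≤-by (ℤ.+-mono-≤ scaledBound (ℤ.+-mono-≤ C*d≤n′ n≤e*b*n))
      (rearrange (S n) a b (+ C) d e (+ n))

-- With `K = suc k`, the hypothesis puts the average above `t` by 1 / (K b), up to a term of order 1
-- / n. Half of this excess serves as `ε`.
¬limSup≤ : ∀ {G} (S : ℕ → ℤ) (t : ℚ) (k H : ℕ) →
  (∀ n → + n ℤ.≤ + suc k ℤ.* (+ ↧ₙ t ℤ.* S n ℤ.- ↥ t ℤ.* + n) ℤ.+ + H) →
  ¬ LimSup≤ {G} (λ n → S n ℚ./ n) t
¬limSup≤ {G} S t@(mkℚ a b-1 _) k H bound limit = contradict (limit ε 0<ε)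
  where
  b d K : ℤ
  b = + suc b-1
  d-1 : ℕ
  d-1 = pred (2 * suc k * suc b-1)
  d = + suc d-1
  K = + suc k

  ε : ℚ
  ε = fromℚᵘ (mkℚᵘ 1ℤ d-1)

  0<ε : 0ℚ ℚ.< ε
  0<ε = ℚ.toℚᵘ-cancel-< (ℚᵘ.<-respʳ-≃ (ℚᵘ.≃-sym (ℚ.toℚᵘ-fromℚᵘ (mkℚᵘ 1ℤ d-1)))
    (ℚᵘ.*<* (ℤ.+<+ (s≤s z≤n))))

  contradict : ¬ ∃ λ N → ∀ n .{{_ : NonZero n}} → N ≤ n → S n ℚ./ n ℚ.≤ t ℚ.+ ε
  contradict (N , average) = <⇒≱ (s≤s (m≤n+m (2 * H) N)) (ℤ.drop‿+≤+ n≤2H)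
    where
    -- This `n` is beyond `N` and exceeds 2 H, whereas twice the hypothesis together with the limit
    -- inequality gives n ≤ 2 H.
    n-1 n : ℕ
    n-1 = N + 2 * H
    n = suc n-1

    average′ : mkℚᵘ (S n) n-1 ℚᵘ.≤ toℚᵘ t ℚᵘ.+ mkℚᵘ 1ℤ d-1
    average′ = ℚᵘ.≤-respˡ-≃ (ℚ.toℚᵘ-fromℚᵘ (mkℚᵘ (S n) n-1))
      (ℚᵘ.≤-respʳ-≃ (ℚᵘ.≃-trans (ℚ.toℚᵘ-homo-+ t ε)
          (ℚᵘ.+-congʳ (toℚᵘ t) (ℚ.toℚᵘ-fromℚᵘ (mkℚᵘ 1ℤ d-1))))
        (ℚ.toℚᵘ-mono-≤ (average n (m≤n⇒m≤1+n (m≤m+n N _)))))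

    cross : S n ℤ.* (b ℤ.* d) ℤ.≤ (a ℤ.* d ℤ.+ 1ℤ ℤ.* b) ℤ.* + n
    cross = ℚᵘ.drop-*≤* average′

    d≡ : d ≡ + 2 ℤ.* K ℤ.* b
    d≡ = trans (ℤ.pos-* (2 * suc k) (suc b-1)) (cong (ℤ._* b) (ℤ.pos-* 2 (suc k)))

    regroupˡ : ∀ S b K → S ℤ.* (b ℤ.* (+ 2 ℤ.* K ℤ.* b)) ≡ + 2 ℤ.* K ℤ.* b ℤ.* S ℤ.* b
    regroupˡ = solve-∀

    regroupʳ : ∀ a b K n → (a ℤ.* (+ 2 ℤ.* K ℤ.* b) ℤ.+ 1ℤ ℤ.* b) ℤ.* n ≡
      (+ 2 ℤ.* K ℤ.* a ℤ.* n ℤ.+ n) ℤ.* b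
    regroupʳ = solve-∀

    cancelled : + 2 ℤ.* K ℤ.* b ℤ.* S n ℤ.≤ + 2 ℤ.* K ℤ.* a ℤ.* + n ℤ.+ + n
    cancelled = ℤ.*-cancelʳ-≤-pos _ _ b (subst₂ ℤ._≤_ (regroupˡ (S n) b K) (regroupʳ a b K (+ n))
      (subst (λ d → S n ℤ.* (b ℤ.* d) ℤ.≤ (a ℤ.* d ℤ.+ 1ℤ ℤ.* b) ℤ.* + n) d≡ cross))

    rearrange : ∀ S a b K H n →
      n ℤ.+ (K ℤ.* (b ℤ.* S ℤ.- a ℤ.* n) ℤ.+ H ℤ.+ (K ℤ.* (b ℤ.* S ℤ.- a ℤ.* n) ℤ.+ H ℤ.+
        (+ 2 ℤ.* K ℤ.* a ℤ.* n ℤ.+ n))) ≡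
      + 2 ℤ.* H ℤ.+ (n ℤ.+ (n ℤ.+ + 2 ℤ.* K ℤ.* b ℤ.* S))
    rearrange = solve-∀

    n≤2H : + n ℤ.≤ + (2 * H)
    n≤2H = subst (+ n ℤ.≤_) (sym (ℤ.pos-* 2 H))
      (≤-by (ℤ.+-mono-≤ (bound n) (ℤ.+-mono-≤ (bound n) cancelled))
        (rearrange (S n) a b K (+ H) (+ n)))

-- Strategies with finite memory

-- `move` ends in a local function applied to `owner s` and `refl`.  Abstracting
-- over both needs refl : owner s ≡ w in which only the right-hand side has been
-- abstracted; writing the left-hand side with z instead of tt, which is equal
-- but only by η, hides it from the abstraction.
move-elim′ : (𝒢 : ⊤ → Game) (z : ⊤) (σ₁ : Strategy (𝒢 z) player₁) (σ₂ : Strategy (𝒢 z) player₂) →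
             ∀ {s₀ s} (p : Path (𝒢 z) s₀ s) (P : ∃ (Game.Edge (𝒢 z) s) → Set) →
             (∀ own → P (σ₁ p own)) → (∀ own → P (σ₂ p own)) → P (move {𝒢 tt} σ₁ σ₂ p)
move-elim′ 𝒢 z σ₁ σ₂ {s = s} p P P₁ P₂
  with Game.owner (𝒢 tt) s | (Game.owner (𝒢 z) s ≡ Game.owner (𝒢 tt) s) ∋ refl
... | player₁ | own = P₁ own
... | player₂ | own = P₂ own

move-elim : ∀ {G} (σ₁ : Strategy G player₁) (σ₂ : Strategy G player₂) →
            ∀ {s₀ s} (p : Path G s₀ s) (P : ∃ (Game.Edge G s) → Set) →
            (∀ own → P (σ₁ p own)) → (∀ own → P (σ₂ p own)) → P (move σ₁ σ₂ p)
move-elim {G} = move-elim′ (λ _ → G) tt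

-- The default `zero` is returned for non-edges, which no play uses, and when the level would leave
-- [0, U], after which player 1 has lost anyway.
follow : ∀ G U → Game.State G → Fin (suc U) → Game.State G → Fin (suc U)
follow G U s c s′ with T? (Game.edge G s s′)
... | no  _ = zero
... | yes e with Fin.any? (next? c (Game.weight G s s′ e))
...   | no  _        = zero
...   | yes (c′ , _) = c′

follow-next : ∀ {G U s c s′ c′} (e : Game.Edge G s s′) →
              Next c (Game.weight G s s′ e) c′ → follow G U s c s′ ≡ c′
follow-next {G} {s = s} {c} {s′} {c′} e nxt with T? (Game.edge G s s′)
... | no  ¬e = ⊥-elim (¬e e)
... | yes e₁ with refl ← T-irrelevant e₁ e with Fin.any? (next? c (Game.weight G s s′ e))
...   | no  none        = ⊥-elim (none (c′ , nxt))
...   | yes (c″ , nxt″) = Fin.toℕ-injective (ℤ.+-injective (trans nxt″ (sym nxt)))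

fromEnergy : ∀ {U i} → 0ℤ ℤ.≤ i → i ℤ.≤ + U → ∃ λ (c : Fin (suc U)) → + toℕ c ≡ i
fromEnergy {i = + m} _ (ℤ.+≤+ m≤U) = fromℕ< (s≤s m≤U) , cong +_ (Fin.toℕ-fromℕ< (s≤s m≤U))

-- All that the analysis of a play uses of the machine. The conditions in `level-suc` and `step` are
-- there because the computed level is only meaningful within the bounds and the move only within
-- `Good`.
record Tracking {G U} (Good : Game.State G → Fin (suc U) → Set)
                (Step : ∀ s → Fin (suc U) → ∀ s′ → Game.Edge G s s′ → Set)
                (π : Play G) : Set where
  open Game G
  open Play π
  field
    level       : ℕ → Fin (suc U)
    level-zero  : level 0 ≡ zero
    level-suc   : ∀ n {c′} → Next (level n) (weight _ _ (edgeAt n)) c′ → level (suc n) ≡ c′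
    step        : ∀ n → Good (state n) (level n) → Step (state n) (level n) (state (suc n)) (edgeAt n)

-- A machine is told which state is left, not which edge is taken, so that its
-- memory has to hold the previous state next to the energy level there.
module LevelMachine
  (G : Game) (U : ℕ) (i : Player)
  (Good : Game.State G → Fin (suc U) → Set)
  (good? : ∀ s c → Dec (Good s c))
  (Step : ∀ s → Fin (suc U) → ∀ s′ → Game.Edge G s s′ → Set)
  (progress : ∀ s c → Good s c → Forcing.Forces G i s (Step s c))
  where
  open Game G

  Level : Set
  Level = Fin (suc U)

  -- The extra memory state is the initial one, before any state has been left.
  memory : ℕ
  memory = suc (#states * suc U)

  level : Fin memory → State → Level
  level zero    s = zero
  level (suc m) s = let s₋ , c = remQuot (suc U) m in follow G U s₋ c s

  opponent≢ : ∀ {j} → j ≢ opponent j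
  opponent≢ {player₁} ()
  opponent≢ {player₂} ()

  -- Outside `Good` an arbitrary edge is taken; a conditional guarantee keeps the machine total.
  choose : ∀ s c → owner s ≡ i → Σ (∃ (Edge s)) λ (s′ , e) → Good s c → Step s c s′ e
  choose s c own with good? s c
  ... | no  ¬good = total s , ⊥-elim ∘ ¬good
  ... | yes good with progress s c good
  ...   | inj₁ (_ , s′ , e , p) = (s′ , e) , λ _ → p
  ...   | inj₂ (opp , _)        = ⊥-elim (opponent≢ (trans (sym own) opp))

  machine : Moore G i memory
  machine = record
    { init   = zero
    ; update = λ m s → suc (combine s (level m s))
    ; next   = λ m s own → proj₁ (choose s (level m s) own)
    }

  open Moore machine using (run; strategy)

  levelAfter : ∀ {s₀ s} → Path G s₀ s → Level
  levelAfter {s = s} p = level (run p) s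

  levelAfter-▷ : ∀ {s₀ s s′ c′} (p : Path G s₀ s) (e : Edge s s′) →
                 Next (levelAfter p) (weight s s′ e) c′ → levelAfter (p ▷ e) ≡ c′
  levelAfter-▷ {s = s} {s′} p e nxt = trans
    (cong (λ ((s₋ , c) : State × Level) → follow G U s₋ c s′) (Fin.remQuot-combine s (levelAfter p)))
    (follow-next {G} e nxt)

  Steps : ∀ {s₀ s} → Path G s₀ s → ∃ (Edge s) → Set
  Steps {s = s} p (s′ , e) = Step s (levelAfter p) s′ e

  own-step : ∀ {s₀ s} (p : Path G s₀ s) → Good s (levelAfter p) → ∀ own → Steps p (strategy p own)
  own-step p good own = proj₂ (choose _ (levelAfter p) own) good

  opponent-step : ∀ {s₀ s} (p : Path G s₀ s) → Good s (levelAfter p) →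
                  owner s ≡ opponent i → ∀ m → Steps p m
  opponent-step p good opp (s′ , e) with progress _ (levelAfter p) good
  ... | inj₁ (own , _) = ⊥-elim (opponent≢ (trans (sym own) opp))
  ... | inj₂ (_ , all) = all s′ e

  module _ (σ₁ : Strategy G player₁) (σ₂ : Strategy G player₂) (s₀ : State)
    (steps : ∀ {s} (p : Path G s₀ s) → Good s (levelAfter p) → Steps p (move σ₁ σ₂ p)) where

    tracking : Tracking Good Step (outcome σ₁ σ₂ s₀)
    tracking = record
      { level      = λ n → levelAfter (proj₂ (history σ₁ σ₂ s₀ n))
      ; level-zero = refl
      ; level-suc  = λ n → levelAfter-▷ (proj₂ (history σ₁ σ₂ s₀ n)) _
      ; step       = λ n → steps (proj₂ (history σ₁ σ₂ s₀ n))
      }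

tracking₁ : ∀ {G U Good good? Step} progress s₀ (τ : Strategy G player₂) →
  let open LevelMachine G U player₁ Good good? Step progress in
  Tracking Good Step (outcome (Moore.strategy machine) τ s₀)
tracking₁ {G} {U} {Good} {good?} {Step} progress s₀ τ =
  tracking (Moore.strategy machine) τ s₀ λ p good →
    move-elim (Moore.strategy machine) τ p (Steps p)
      (own-step p good) (λ opp → opponent-step p good opp _)
  where open LevelMachine G U player₁ Good good? Step progress

tracking₂ : ∀ {G U Good good? Step} progress s₀ (σ : Strategy G player₁) →
  let open LevelMachine G U player₂ Good good? Step progress in
  Tracking Good Step (outcome σ (Moore.strategy machine) s₀)
tracking₂ {G} {U} {Good} {good?} {Step} progress s₀ σ =
  tracking σ (Moore.strategy machine) s₀ λ p good →
    move-elim σ (Moore.strategy machine) p (Steps p)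
      (λ opp → opponent-step p good opp _) (own-step p good)
  where open LevelMachine G U player₂ Good good? Step progress

-- From certificates to winning machines

module _ {G : Game} (π : Play G) (a b : ℤ) where

  -- Telescoping: the potential pays for the rewards, whose sum up to `n` is
  -- `b * sumEL π n - a * n`.
  Σ≤ : (q : ℕ → ℤ) → (∀ n → b ℤ.* EL π (suc n) ℤ.- a ℤ.+ q (suc n) ℤ.≤ q n) →
       ∀ n → b ℤ.* sumEL π n ℤ.+ q n ℤ.≤ a ℤ.* + n ℤ.+ q 0
  Σ≤ q decrease zero = ℤ.≤-reflexive (cong (ℤ._+ q 0) (trans (ℤ.*-zeroʳ b) (sym (ℤ.*-zeroʳ a))))
  Σ≤ q decrease (suc n) = ≤-by (ℤ.+-mono-≤ (decrease n) (Σ≤ q decrease n))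
    (rearrange b (EL π (suc n)) a (sumEL π n) (q n) (q (suc n)) (+ n) (q 0))
    where
    rearrange : ∀ b c a S q q′ n q₀ →
      b ℤ.* (S ℤ.+ c) ℤ.+ q′ ℤ.+ (q ℤ.+ (a ℤ.* n ℤ.+ q₀)) ≡
      a ℤ.* (1ℤ ℤ.+ n) ℤ.+ q₀ ℤ.+ (b ℤ.* c ℤ.- a ℤ.+ q′ ℤ.+ (b ℤ.* S ℤ.+ q))
    rearrange = solve-∀

  -- Up to the change of potential, each step contributes at least 1 to the scaled rewards; these
  -- contributions add up to `n`.
  Σ≥ : (K : ℤ) (x : ℕ → ℤ) →
       (∀ n → x n ℤ.≤ x (suc n) ℤ.+ (K ℤ.* (b ℤ.* EL π (suc n) ℤ.- a) ℤ.- 1ℤ)) →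
       ∀ n → + n ℤ.+ x 0 ℤ.≤ K ℤ.* (b ℤ.* sumEL π n ℤ.- a ℤ.* + n) ℤ.+ x n
  Σ≥ K x increase zero = ℤ.≤-reflexive (cong (ℤ._+ x 0) (zeros K b a))
    where
    zeros : ∀ K b a → 0ℤ ≡ K ℤ.* (b ℤ.* 0ℤ ℤ.- a ℤ.* 0ℤ)
    zeros = solve-∀
  Σ≥ K x increase (suc n) = ≤-by (ℤ.+-mono-≤ (increase n) (Σ≥ K x increase n))
    (rearrange K b (EL π (suc n)) a (sumEL π n) (x n) (x (suc n)) (+ n) (x 0))
    where
    rearrange : ∀ K b c a S x x′ n x₀ →
      1ℤ ℤ.+ n ℤ.+ x₀ ℤ.+
        (x′ ℤ.+ (K ℤ.* (b ℤ.* c ℤ.- a) ℤ.- 1ℤ) ℤ.+ (K ℤ.* (b ℤ.* S ℤ.- a ℤ.* n) ℤ.+ x)) ≡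
      K ℤ.* (b ℤ.* (S ℤ.+ c) ℤ.- a ℤ.* (1ℤ ℤ.+ n)) ℤ.+ x′ ℤ.+ (x ℤ.+ (n ℤ.+ x₀))
    rearrange = solve-∀

module AverageEnergy (G : Game) (U : ℕ) (t : ℚ) (s₀ : Game.State G) where
  open Game G

  W : Objective {G}
  W π = EnergyLU U 0 π × AvgEnergy t π

  a b : ℤ
  a = ↥ t
  b = + ↧ₙ t

  -- The denominator of `t` is cleared: this is `b` times the excess of the level over `t`, so that
  -- the threshold becomes 0.
  reward : Fin (suc U) → ℤ
  reward c = b ℤ.* + toℕ c ℤ.- a

  open Determinacy G U reward public
    using (Certificate₁; Certificate₂; determined)

  memory : ℕ
  memory = suc (#states * suc U)

  module Minimiser (cert : Certificate₁ s₀ zero) where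
    open Certificate₁ cert

    Step : ∀ s → Fin (suc U) → ∀ s′ → Edge s s′ → Set
    Step s c s′ e = ∃ λ c′ → Next c (weight s s′ e) c′ × Good s′ c′ ×
      reward c′ ℤ.+ + potential s′ c′ ℤ.≤ + potential s c

    module _ (π : Play G) (start : Play.state π 0 ≡ s₀) (track : Tracking Good Step π) where
      open Play π
      open Tracking track

      initially : Good (state 0) (level 0)
      initially = subst₂ Good (sym start) (sym level-zero) initial

      -- Mutual induction: `Good` provides a next level within bounds, which the machine then
      -- follows and which is `Good` again.
      matches : ∀ n → + toℕ (level n) ≡ EL π n × Good (state n) (level n)
      stepped : ∀ n → Step (state n) (level n) (state (suc n)) (edgeAt n)
      stepped n = step n (proj₂ (matches n))
      arrives : ∀ n → level (suc n) ≡ proj₁ (stepped n)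
      arrives n = level-suc n (proj₁ (proj₂ (stepped n)))

      matches zero = cong (λ c → + toℕ c) level-zero , initially
      matches (suc n) with stepped n | arrives n
      ... | c′ , nxt , good′ , _ | refl =
        trans nxt (cong (ℤ._+ weight _ _ (edgeAt n)) (proj₁ (matches n))) , good′

      q : ℕ → ℤ
      q n = + potential (state n) (level n)

      decrease : ∀ n → b ℤ.* EL π (suc n) ℤ.- a ℤ.+ q (suc n) ℤ.≤ q n
      decrease n = subst₂ (λ e c → b ℤ.* e ℤ.- a ℤ.+ + potential (state (suc n)) c ℤ.≤ q n)
        (trans (sym (cong (λ c → + toℕ c) (arrives n))) (proj₁ (matches (suc n))))
        (sym (arrives n))
        (proj₂ (proj₂ (proj₂ (stepped n))))

      energy : EnergyLU U 0 π
      energy n = subst (λ e → 0ℤ ℤ.≤ e × e ℤ.≤ + U)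
        (trans (proj₁ (matches n)) (sym (ℤ.+-identityˡ (EL π n))))
        (ℤ.+≤+ z≤n , ℤ.+≤+ (s≤s⁻¹ (Fin.toℕ<n (level n))))

      satisfied : W π
      -- The error constant is the initial potential; the final potential is nonnegative and is
      -- dropped.
      satisfied = energy , limSup≤ {G} (sumEL π) t _ λ n →
        ℤ.≤-trans (ℤ.i≤i+j (b ℤ.* sumEL π n) (q n)) (Σ≤ π a b q decrease n)

  module Maximiser (cert : Certificate₂ s₀ zero) where
    open Certificate₂ cert

    K : ℤ
    K = + suc factor

    Step : ∀ s → Fin (suc U) → ∀ s′ → Edge s s′ → Set
    Step s c s′ e = ∀ c′ → Next c (weight s s′ e) c′ → Good s′ c′ ×
      + potential s c ℤ.≤ + potential s′ c′ ℤ.+ (K ℤ.* reward c′ ℤ.- 1ℤ)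

    module _ (π : Play G) (start : Play.state π 0 ≡ s₀) (track : Tracking Good Step π)
             (energy : EnergyLU U 0 π) where
      open Play π
      open Tracking track

      -- The certificate of player 2 provides no next level; it comes from the assumption that the
      -- play respects the energy bounds.
      currentLevel : ∀ n → ∃ λ (c : Fin (suc U)) → + toℕ c ≡ EL π n
      currentLevel n = fromEnergy (subst (0ℤ ℤ.≤_) (ℤ.+-identityˡ _) (proj₁ (energy n)))
        (subst (ℤ._≤ + U) (ℤ.+-identityˡ _) (proj₂ (energy n)))

      initially : Good (state 0) (level 0)
      initially = subst₂ Good (sym start) (sym level-zero) initial

      matches : ∀ n → + toℕ (level n) ≡ EL π n × Good (state n) (level n)
      next : ∀ n → Next (level n) (weight _ _ (edgeAt n)) (proj₁ (currentLevel (suc n)))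
      next n = trans (proj₂ (currentLevel (suc n)))
        (cong (ℤ._+ weight _ _ (edgeAt n)) (sym (proj₁ (matches n))))
      arrives : ∀ n → level (suc n) ≡ proj₁ (currentLevel (suc n))
      arrives n = level-suc n (next n)

      matches zero = cong (λ c → + toℕ c) level-zero , initially
      matches (suc n) =
        trans (cong (λ c → + toℕ c) (arrives n)) (proj₂ (currentLevel (suc n))) ,
        subst (Good (state (suc n))) (sym (arrives n))
          (proj₁ (step n (proj₂ (matches n)) _ (next n)))

      x : ℕ → ℤ
      x n = + potential (state n) (level n)

      increase : ∀ n → x n ℤ.≤ x (suc n) ℤ.+ (K ℤ.* (b ℤ.* EL π (suc n) ℤ.- a) ℤ.- 1ℤ)
      increase n = subst₂
        (λ c e → x n ℤ.≤ + potential (state (suc n)) c ℤ.+ (K ℤ.* (b ℤ.* e ℤ.- a) ℤ.- 1ℤ))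
        (sym (arrives n)) (proj₂ (currentLevel (suc n)))
        (proj₂ (step n (proj₂ (matches n)) _ (next n)))

      average : ∀ n → + n ℤ.≤ K ℤ.* (b ℤ.* sumEL π n ℤ.- a ℤ.* + n) ℤ.+ + bound
      average n = ℤ.≤-trans (ℤ.i≤i+j (+ n) (x 0)) (ℤ.≤-trans (Σ≥ π a b K x increase n)
        (ℤ.+-monoʳ-≤ (K ℤ.* (b ℤ.* sumEL π n ℤ.- a ℤ.* + n)) (ℤ.+≤+ (bounded (state n) (level n)))))

      violated : ¬ AvgEnergy t π
      violated = ¬limSup≤ {G} (sumEL π) t factor bound average

  machine₁ : Certificate₁ s₀ zero →
    ∃ λ (M : Moore G player₁ memory) → Winning W s₀ player₁ (Moore.strategy M)
  machine₁ cert = LevelMachine.machine G U player₁ Good good? Step progress ,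
    λ τ → satisfied _ refl (tracking₁ {good? = good?} progress s₀ τ)
    where
    open Certificate₁ cert
    open Minimiser cert

  machine₂ : Certificate₂ s₀ zero →
    ∃ λ (M : Moore G player₂ memory) → Winning W s₀ player₂ (Moore.strategy M)
  machine₂ cert = LevelMachine.machine G U player₂ Good good? Step progress ,
    λ σ (energy , limit) → violated _ refl (tracking₂ {good? = good?} progress s₀ σ) energy limit
    where
    open Certificate₂ cert
    open Maximiser cert

  -- If the certificate belonged to the opponent, the opponent's machine would beat the given
  -- strategy.
  finiteMemory : ∀ i → (∃ λ (σ : Strategy G i) → Winning W s₀ i σ) →
    ∃ λ (M : Moore G i memory) → Winning W s₀ i (Moore.strategy M)
  finiteMemory i (σ , wins) with determined s₀ zero
  finiteMemory player₁ (σ , wins) | inj₁ c = machine₁ c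
  finiteMemory player₁ (σ , wins) | inj₂ c =
    let M , wins₂ = machine₂ c in ⊥-elim (wins₂ σ (wins (Moore.strategy M)))
  finiteMemory player₂ (σ , wins) | inj₁ c =
    let M , wins₁ = machine₁ c in ⊥-elim (wins (Moore.strategy M) (wins₁ σ))
  finiteMemory player₂ (σ , wins) | inj₂ c = machine₂ c

-- Families that require counting

n<2^n : ∀ n → n < 2 ^ n
n<2^n zero    = s≤s z≤n
n<2^n (suc n) = ≤-trans (+-mono-≤ (m^n>0 2 n) (n<2^n n))
  (≤-reflexive (cong (λ m → 2 ^ n + m) (sym (+-identityʳ (2 ^ n)))))

-- At arguments up to `2 ^ s` the logarithm of the value is at most linear in `s`; `suc s` instead
-- of `s` leaves room for constants.
eval-growth : (p : Polynomial 1) → ∃ λ k → ∀ s x → x ≤ 2 ^ s → eval₁ p x ≤ 2 ^ (k * suc s)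
eval-growth (con c) = c , λ s x _ →
  ≤-trans (<⇒≤ (n<2^n c)) (^-monoʳ-≤ 2 (m≤m*n c (suc s)))
eval-growth (var zero) = 1 , λ s x x≤ →
  ≤-trans x≤ (^-monoʳ-≤ 2 (≤-trans (n≤1+n s) (≤-reflexive (sym (*-identityˡ (suc s))))))
eval-growth (p ⊕ q) with k , p≤ ← eval-growth p | l , q≤ ← eval-growth q =
  suc (k + l) , λ s x x≤ → begin
    eval₁ p x + eval₁ q x
      ≤⟨ +-mono-≤ (≤-trans (p≤ s x x≤) (^-monoʳ-≤ 2 (*-monoˡ-≤ (suc s) (m≤m+n k l))))
                  (≤-trans (q≤ s x x≤) (^-monoʳ-≤ 2 (*-monoˡ-≤ (suc s) (m≤n+m l k)))) ⟩
    2 ^ ((k + l) * suc s) + 2 ^ ((k + l) * suc s)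
      ≡⟨ cong (λ m → 2 ^ ((k + l) * suc s) + m) (+-identityʳ _) ⟨
    2 ^ suc ((k + l) * suc s)
      ≤⟨ ^-monoʳ-≤ 2 (s≤s (m≤n+m _ s)) ⟩
    2 ^ (suc (k + l) * suc s) ∎
  where open ≤-Reasoning
eval-growth (p ⊗ q) with k , p≤ ← eval-growth p | l , q≤ ← eval-growth q =
  k + l , λ s x x≤ → begin
    eval₁ p x * eval₁ q x                 ≤⟨ *-mono-≤ (p≤ s x x≤) (q≤ s x x≤) ⟩
    2 ^ (k * suc s) * 2 ^ (l * suc s)     ≡⟨ ^-distribˡ-+-* 2 (k * suc s) (l * suc s) ⟨
    2 ^ (k * suc s + l * suc s)           ≡⟨ cong (2 ^_) (*-distribʳ-+ (suc s) k l) ⟨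
    2 ^ ((k + l) * suc s)                 ∎
  where open ≤-Reasoning

linear<2^ : ∀ K → ∃ λ r → K * suc r < 2 ^ r
-- With n = 2 K + 1, completing the square gives K (2 n + 1) + K + 1 = n * n.
linear<2^ K = n + n , (begin-strict
  K * suc (n + n)    ≤⟨ m≤m+n _ (suc K) ⟩
  K * suc (n + n) + suc K ≡⟨ square K ⟩
  n * n              <⟨ *-mono-< (n<2^n n) (n<2^n n) ⟩
  2 ^ n * 2 ^ n      ≡⟨ ^-distribˡ-+-* 2 n n ⟨
  2 ^ (n + n)        ∎)
  where
  open ≤-Reasoning
  n = suc (2 * K)
  square : ∀ K → K * suc (suc (2 * K) + suc (2 * K)) + suc K ≡ suc (2 * K) * suc (2 * K)
  square = ℕ-Solver.solve-∀

-- This serves to choose U = `2 ^ (2 ^ r)`, where sizes are polynomial in `2 ^ r`: a polynomial in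
-- such a size is at most exponential in a linear function of `r`, hence below U.
eval<2^ : (p q : Polynomial 1) → ∃ λ r → ∀ x → x ≤ eval₁ q (2 ^ r) → eval₁ p x < 2 ^ (2 ^ r)
eval<2^ p q with k , p≤ ← eval-growth p | l , q≤ ← eval-growth q
  with r , small ← linear<2^ (k + k * l) = r , λ x x≤ → begin-strict
    eval₁ p x                  ≤⟨ p≤ (l * suc r) x (≤-trans x≤ (q≤ r (2 ^ r) ≤-refl)) ⟩
    2 ^ (k * suc (l * suc r))  <⟨ ^-monoʳ-< 2 (s≤s (s≤s z≤n)) (≤-<-trans (bound k l r) small) ⟩
    2 ^ (2 ^ r)                ∎
  where
  open ≤-Reasoning
  expand : ∀ k l r → k * suc (l * suc r) + k * r ≡ (k + k * l) * suc r
  expand = ℕ-Solver.solve-∀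
  bound : ∀ k l r → k * suc (l * suc r) ≤ (k + k * l) * suc r
  bound k l r = ≤-trans (m≤m+n _ (k * r)) (≤-reflexive (expand k l r))

-- An orbit of length at most U would be periodic before time U.
orbit-length : ∀ {m U} (f : Fin m → Fin m) (x : ℕ → Fin m) → (∀ k → x (suc k) ≡ f (x k)) →
               (P : Fin m → Set) → (∀ k → k < U → P (x k)) → ¬ P (x U) → U < m
orbit-length {m} {U} f x orbit P before after with U <? m
... | yes U<m = U<m
... | no  U≮m with i , j , i<j , xᵢ≡xⱼ ← Fin.pigeonhole (s≤s (≮⇒≥ U≮m)) (x ∘ toℕ) =
  ⊥-elim (after (subst P (trans (shift d xᵢ≡xⱼ) (cong x (trans (+-comm d (toℕ j)) (m+[n∸m]≡n j≤U))))
    (before (d + toℕ i) (subst (d + toℕ i <_) (m∸n+n≡m j≤U) (+-monoʳ-< d i<j)))))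
  where
  j≤U = s≤s⁻¹ (Fin.toℕ<n j)
  d = U ∸ toℕ j
  shift : ∀ {i j} d → x i ≡ x j → x (d + i) ≡ x (d + j)
  shift zero    eq = eq
  shift (suc d) eq = trans (orbit _) (trans (cong f (shift d eq)) (sym (orbit _)))

Within : ℕ → ℤ → Set
Within U e = 0ℤ ℤ.≤ e × e ℤ.≤ + U

module _ {G : Game} where
  open Game G

  -- Strategies see finite paths and not plays, so that energies and invariants are phrased on
  -- paths.
  pathEnergy : ∀ {s₀ s} → Path G s₀ s → ℤ
  pathEnergy start                = 0ℤ
  pathEnergy (_▷_ {s} {s′} p e) = pathEnergy p ℤ.+ weight s s′ e

  module _ (σ₁ : Strategy G player₁) (σ₂ : Strategy G player₂) (s₀ : State) where
    private
      h = history σ₁ σ₂ s₀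
      π = outcome σ₁ σ₂ s₀

    EL≡pathEnergy : ∀ n → EL π n ≡ pathEnergy (proj₂ (h n))
    EL≡pathEnergy zero    = refl
    EL≡pathEnergy (suc n) = cong (λ e → e ℤ.+ weight _ _ (Play.edgeAt π n)) (EL≡pathEnergy n)

    within⇒energyLU : ∀ {U} → (∀ n → Within U (pathEnergy (proj₂ (h n)))) → EnergyLU U 0 π
    within⇒energyLU {U} w n =
      subst (Within U) (sym (trans (ℤ.+-identityˡ (EL π n)) (EL≡pathEnergy n))) (w n)

    energyLU⇒within : ∀ {U} → EnergyLU U 0 π → ∀ n → Within U (pathEnergy (proj₂ (h n)))
    energyLU⇒within {U} w n =
      subst (Within U) (trans (ℤ.+-identityˡ (EL π n)) (EL≡pathEnergy n)) (w n)

    extend : ∃ (Path G s₀) → ∃ (Path G s₀)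
    extend (_ , p) = let s′ , e = move σ₁ σ₂ p in s′ , p ▷ e

    history-invariant : (I : ∃ (Path G s₀) → Set) → I (s₀ , start) →
                        (∀ sp → I sp → I (extend sp)) → ∀ n → I (h n)
    history-invariant I base step zero    = base
    history-invariant I base step (suc n) = step (h n) (history-invariant I base step n)

sum≤U : ∀ {m n U} → m + n ≤ U → Within U (+ m ℤ.+ + n)
sum≤U m+n≤U = ℤ.+≤+ z≤n , ℤ.+≤+ m+n≤U

¬within-above : ∀ {U} → ¬ Within U (+ U ℤ.+ 1ℤ)
¬within-above {U} (_ , ℤ.+≤+ U+1≤U) = <⇒≱ (≤-reflexive (sym (+-comm U 1))) U+1≤U

¬within-below : ∀ {k U} → k < U → ¬ Within U (+ k ℤ.+ ℤ.- + U)
¬within-below k<U (0≤ , _) = <⇒≱ k<U (ℤ.drop‿+≤+ (ℤ.0≤i-j⇒j≤i 0≤))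

-- Player 1 must loop exactly U times, as the way out costs U.
module Counting₁ (U : ℕ) where

  edges : Fin 2 → Fin 2 → Bool
  edges zero       zero       = true
  edges zero       (suc zero) = true
  edges (suc zero) zero       = true
  edges (suc zero) (suc zero) = false

  weights : ∀ s s′ → T (edges s s′) → ℤ
  weights zero       zero       _ = 1ℤ
  weights zero       (suc zero) _ = ℤ.- + U
  weights (suc zero) zero       _ = 0ℤ
  weights (suc zero) (suc zero) ()

  totals : ∀ s → ∃ λ s′ → T (edges s s′)
  totals zero       = zero , tt
  totals (suc zero) = zero , tt

  G : Game
  G = record { #states = 2 ; owner = λ _ → player₁ ; edge = edges ; weight = weights ; total = totals }

  open Game G using (State)

  climb : Strategy G player₁
  climb {s = zero} p _ with pathEnergy p ℤ.≟ + U
  ... | yes _ = suc zero , tt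
  ... | no  _ = zero , tt
  climb {s = suc zero} p _ = zero , tt

  Safe : ∃ (Path G zero) → Set
  Safe (zero     , p) = Within U (pathEnergy p)
  Safe (suc zero , p) = pathEnergy p ≡ 0ℤ

  within : ∀ sp → Safe sp → Within U (pathEnergy (proj₂ sp))
  within (zero     , p) w  = w
  within (suc zero , p) eq = subst (Within U) (sym eq) (ℤ.+≤+ z≤n , ℤ.+≤+ z≤n)

  climb-wins : Winning (EnergyLU U 0) zero player₁ climb
  climb-wins τ = within⇒energyLU climb τ zero λ n →
    within (history climb τ zero n)
      (history-invariant climb τ zero Safe (ℤ.+≤+ z≤n , ℤ.+≤+ z≤n) step n)
    where
    bump : ∀ e → Within U e → e ≢ + U → Within U (e ℤ.+ 1ℤ)
    bump (+ k) (_ , ℤ.+≤+ k≤U) k≢U =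
      sum≤U {k} {1} (subst (_≤ U) (+-comm 1 k) (≤∧≢⇒< k≤U (λ k≡U → k≢U (cong (λ m → + m) k≡U))))

    step : ∀ sp → Safe sp → Safe (extend climb τ zero sp)
    step (zero , p) w with pathEnergy p ℤ.≟ + U
    ... | yes eq = trans (cong (ℤ._+ ℤ.- + U) eq) (ℤ.+-inverseʳ (+ U))
    ... | no  ne = bump (pathEnergy p) w ne
    step (suc zero , p) eq = subst (Within U) (sym (cong (ℤ._+ 0ℤ) eq)) (ℤ.+≤+ z≤n , ℤ.+≤+ z≤n)

  loops : ℕ → Path G zero zero
  loops zero    = start
  loops (suc k) = loops k ▷ tt

  loops-energy : ∀ k → pathEnergy (loops k) ≡ + k
  loops-energy zero    = refl
  loops-energy (suc k) = trans (cong (ℤ._+ 1ℤ) (loops-energy k)) (cong (λ m → + m) (+-comm k 1))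

  -- On the loop the memory follows the orbit of one function. Leaving below level U makes the
  -- energy negative, and looping at level U makes it exceed U.
  memory-bound : ∀ {m} (M : Moore G player₁ m) →
                 Winning (EnergyLU U 0) zero player₁ (Moore.strategy M) → U < m
  memory-bound M wins =
    orbit-length (λ m → update m zero) (run ∘ loops) (λ _ → refl) Stays stays leaves
    where
    open Moore M
    -- Player 2 owns no state, so that an arbitrary opponent will do.
    τ : Strategy G player₂
    τ {s = s} _ _ = totals s

    w = energyLU⇒within strategy τ zero (wins τ)
    h = history strategy τ zero

    Stays : Fin _ → Set
    Stays m = proj₁ (next m zero refl) ≡ zero

    after : ∀ {k} → h k ≡ (zero , loops k) →
      Within U (pathEnergy (loops k ▷ proj₂ (next (run (loops k)) zero refl)))
    after {k} eq =
      subst (λ sp → Within U (pathEnergy (proj₂ (extend strategy τ zero sp)))) eq (w (suc k))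

    stays-at : ∀ {k} → h k ≡ (zero , loops k) → k < U → Stays (run (loops k))
    stays-at {k} eq k<U with next (run (loops k)) zero refl | after eq
    ... | zero     , _ | _  = refl
    ... | suc zero , _ | w′ = ⊥-elim (¬within-below k<U
      (subst (λ e → Within U (e ℤ.+ ℤ.- + U)) (loops-energy k) w′))

    follows : ∀ k → k ≤ U → h k ≡ (zero , loops k)
    follows zero    _   = refl
    follows (suc k) k<U = trans (cong (extend strategy τ zero) (follows k (<⇒≤ k<U)))
      (extend≡ k (stays-at (follows k (<⇒≤ k<U)) k<U))
      where
      extend≡ : ∀ k → Stays (run (loops k)) →
        extend strategy τ zero (zero , loops k) ≡ (zero , loops (suc k))
      extend≡ k stay with next (run (loops k)) zero refl | stay
      ... | zero , _ | _ = refl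

    stays : ∀ k → k < U → Stays (run (loops k))
    stays k k<U = stays-at (follows k (<⇒≤ k<U)) k<U

    leaves : ¬ Stays (run (loops U))
    leaves stay with next (run (loops U)) zero refl | stay | after (follows U ≤-refl)
    ... | zero , _ | _ | w′ = ¬within-above (subst (λ e → Within U (e ℤ.+ 1ℤ)) (loops-energy U) w′)

-- Player 1 climbs to a level of its choice; then player 2 must go right at level U
-- and left below it, since the other answer is harmless.
module Counting₂ (U : ℕ) where

  pattern s₀    = zero
  pattern s₁    = suc zero
  pattern left  = suc (suc zero)
  pattern right = suc (suc (suc zero))

  owners : Fin 4 → Player
  owners s₀    = player₁
  owners s₁    = player₂
  owners left  = player₁
  owners right = player₁

  edges : Fin 4 → Fin 4 → Bool
  edges s₀    s₀    = true
  edges s₀    s₁    = true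
  edges s₁    left  = true
  edges s₁    right = true
  edges left  left  = true
  edges right right = true
  edges _     _     = false

  weights : ∀ s s′ → T (edges s s′) → ℤ
  weights s₀ s₀    _ = 1ℤ
  weights s₁ left  _ = ℤ.- + U
  weights s₁ right _ = 1ℤ
  weights _  _     _ = 0ℤ

  totals : ∀ s → ∃ λ s′ → T (edges s s′)
  totals s₀    = s₀ , tt
  totals s₁    = left , tt
  totals left  = left , tt
  totals right = right , tt

  G : Game
  G = record { #states = 4 ; owner = owners ; edge = edges ; weight = weights ; total = totals }

  loops : ℕ → Path G s₀ s₀
  loops zero    = start
  loops (suc k) = loops k ▷ tt

  loops-energy : ∀ k → pathEnergy (loops k) ≡ + k
  loops-energy zero    = refl
  loops-energy (suc k) = trans (cong (ℤ._+ 1ℤ) (loops-energy k)) (cong (λ m → + m) (+-comm k 1))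

  enter : ℕ → Path G s₀ s₁
  enter k = loops k ▷ tt

  enter-energy : ∀ k → pathEnergy (enter k) ≡ + k
  enter-energy k = trans (ℤ.+-identityʳ (pathEnergy (loops k))) (loops-energy k)

  answer : Strategy G player₂
  answer {s = s₁} p _ with pathEnergy p ℤ.≟ + U
  ... | yes _ = right , tt
  ... | no  _ = left , tt
  answer {s = s₀}    _ ()
  answer {s = left}  _ ()
  answer {s = right} _ ()

  -- If the energy stayed in bounds, player 1 could never move to `s₁`, as the answer there violates
  -- the bounds; but looping `suc U` times violates them as well.
  answer-wins : Winning (EnergyLU U 0) s₀ player₂ answer
  answer-wins σ energy = ¬within-above (subst (Within U)
    (trans (cong (pathEnergy ∘ proj₂) (follows (suc U)))
      (trans (loops-energy (suc U)) (cong (λ m → + m) (+-comm 1 U))))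
    (w (suc U)))
    where
    w = energyLU⇒within σ answer s₀ energy
    h = history σ answer s₀

    caught : ∀ k → k ≤ U → ¬ Within U (pathEnergy (proj₂ (extend σ answer s₀ (s₁ , enter k))))
    caught k k≤U w′ with pathEnergy (enter k) ℤ.≟ + U
    ... | yes eq = ¬within-above (subst (λ e → Within U (e ℤ.+ 1ℤ)) eq w′)
    ... | no  ne = ¬within-below
      (≤∧≢⇒< k≤U (λ k≡U → ne (trans (enter-energy k) (cong (λ m → + m) k≡U))))
      (subst (λ e → Within U (e ℤ.+ ℤ.- + U)) (enter-energy k) w′)

    k≤U : ∀ {k} → h k ≡ (s₀ , loops k) → k ≤ U
    k≤U {k} eq = ℤ.drop‿+≤+ (subst (ℤ._≤ + U)
      (trans (cong (pathEnergy ∘ proj₂) eq) (loops-energy k)) (proj₂ (w k)))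

    stay : ∀ k → h k ≡ (s₀ , loops k) → extend σ answer s₀ (s₀ , loops k) ≡ (s₀ , loops (suc k))
    stay k eq with σ (loops k) refl in dir
    ... | s₀ , _ = refl
    -- The violation only shows after the answer, two steps after time `k`.
    ... | s₁ , _ = ⊥-elim (caught k (k≤U eq) (subst (Within U ∘ pathEnergy ∘ proj₂)
      (cong (extend σ answer s₀) (trans (cong (extend σ answer s₀) eq)
        (cong (λ (s′ , e) → s′ , loops k ▷ e) dir)))
      (w (suc (suc k)))))

    follows : ∀ k → h k ≡ (s₀ , loops k)
    follows zero    = refl
    follows (suc k) = trans (cong (extend σ answer s₀) (follows k)) (stay k (follows k))

  climbTo : ℕ → Strategy G player₁
  climbTo k {s = s₀} p _ with pathEnergy p ℤ.≟ + k
  ... | yes _ = s₁ , tt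
  ... | no  _ = s₀ , tt
  climbTo k {s = s₁}    p ()
  climbTo k {s = left}  p _ = left , tt
  climbTo k {s = right} p _ = right , tt

  -- `enter k` and `loops (suc k)` lead to the same memory, because updates only see the state that
  -- is left; hence the memories on arrival at `s₁` form an orbit.
  memory-bound : ∀ {m} (M : Moore G player₂ m) →
                 Winning (EnergyLU U 0) s₀ player₂ (Moore.strategy M) → U < m
  memory-bound M wins = orbit-length (λ m → update m s₀) (run ∘ enter) (λ _ → refl) Left lefts rights
    where
    open Moore M

    Left : Fin _ → Set
    Left m = proj₁ (next m s₁ refl) ≡ left

    -- An answer within bounds at level `k` would let `climbTo k` win, since no later edge changes
    -- the energy.
    module _ (k : ℕ) (k≤U : k ≤ U)
      (safe : Within U (pathEnergy (enter k ▷ proj₂ (next (run (enter k)) s₁ refl)))) where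

      data Safe : ∃ (Path G s₀) → Set where
        climbing : ∀ {j} → j ≤ k → Safe (s₀ , loops j)
        asking   : Safe (s₁ , enter k)
        onLeft   : ∀ {p} → Within U (pathEnergy p) → Safe (left , p)
        onRight  : ∀ {p} → Within U (pathEnergy p) → Safe (right , p)

      within : ∀ {sp} → Safe sp → Within U (pathEnergy (proj₂ sp))
      within (climbing {j} j≤k) = subst (Within U) (sym (loops-energy j))
        (ℤ.+≤+ z≤n , ℤ.+≤+ (≤-trans j≤k k≤U))
      within asking             = subst (Within U) (sym (enter-energy k)) (ℤ.+≤+ z≤n , ℤ.+≤+ k≤U)
      within (onLeft w)         = w
      within (onRight w)        = w

      asked : ∀ m → Within U (pathEnergy (enter k ▷ proj₂ m)) → Safe (proj₁ m , enter k ▷ proj₂ m)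
      asked (s₀    , ()) _
      asked (s₁    , ()) _
      asked (left  , _)  w = onLeft w
      asked (right , _)  w = onRight w

      step : ∀ sp → Safe sp → Safe (extend (climbTo k) strategy s₀ sp)
      step _ (climbing {j} j≤k) with pathEnergy (loops j) ℤ.≟ + k
      ... | yes eq with refl ← ℤ.+-injective (trans (sym (loops-energy j)) eq) = asking
      ... | no  ne = climbing (≤∧≢⇒< j≤k λ j≡k → ne (trans (loops-energy j) (cong (λ m → + m) j≡k)))
      step _ asking = asked (next (run (enter k)) s₁ refl) safe
      step _ (onLeft {p} w)  = onLeft (subst (Within U) (sym (ℤ.+-identityʳ (pathEnergy p))) w)
      step _ (onRight {p} w) = onRight (subst (Within U) (sym (ℤ.+-identityʳ (pathEnergy p))) w)

      unsafe : ⊥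
      unsafe = wins (climbTo k) (within⇒energyLU (climbTo k) strategy s₀ λ n →
        within (history-invariant (climbTo k) strategy s₀ Safe (climbing z≤n) step n))

    lefts : ∀ k → k < U → Left (run (enter k))
    lefts k k<U with next (run (enter k)) s₁ refl | unsafe k (<⇒≤ k<U)
    ... | left  , _ | _     = refl
    ... | right , _ | wrong = ⊥-elim (wrong (subst (λ e → Within U (e ℤ.+ 1ℤ)) (sym (enter-energy k))
      (sum≤U {k} {1} (subst (_≤ U) (+-comm 1 k) k<U))))

    rights : ¬ Left (run (enter U))
    rights isLeft with next (run (enter U)) s₁ refl | isLeft | unsafe U ≤-refl
    ... | left , _ | _ | wrong = wrong (subst (λ e → Within U (e ℤ.+ ℤ.- + U)) (sym (enter-energy U))
      (subst (Within U) (sym (ℤ.+-inverseʳ (+ U))) (ℤ.+≤+ z≤n , ℤ.+≤+ z≤n)))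

-- Memory bounds

-- Levels within the bounds are at most U, and so are their averages. Using `mkℚ` lets numerator and
-- denominator compute in `counting-size`.
trivialThreshold : ℕ → ℚ
trivialThreshold U = mkℚ (+ U) 0 (Coprimality.sym (Coprimality.1-coprimeTo U))

energy⇒average : ∀ {G : Game} U (π : Play G) → EnergyLU U 0 π → AvgEnergy (trivialThreshold U) π
energy⇒average {G} U π energy = limSup≤ {G} (sumEL π) (trivialThreshold U) 0 λ n →
  subst₂ ℤ._≤_ (sym (ℤ.*-identityˡ (sumEL π n))) (sym (ℤ.+-identityʳ (+ U ℤ.* + n))) (sum≤ n)
  where
  sum≤ : ∀ n → sumEL π n ℤ.≤ + U ℤ.* + n
  sum≤ zero    = ℤ.≤-reflexive (sym (ℤ.*-zeroʳ (+ U)))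
  sum≤ (suc n) = subst (sumEL π (suc n) ℤ.≤_)
    (trans (ℤ.+-comm (+ U ℤ.* + n) (+ U)) (sym (ℤ.*-suc (+ U) (+ n))))
    (ℤ.+-mono-≤ (sum≤ n) (subst (ℤ._≤ + U) (ℤ.+-identityˡ (EL π (suc n))) (proj₂ (energy (suc n)))))

-- Player 1 wins by meeting the objective and player 2 by avoiding it, hence the two directions.
winning-map : ∀ {G : Game} {W W′ : Objective {G}} → (∀ π → W π → W′ π) → (∀ π → W′ π → W π) →
              ∀ {s₀} i {σ : Strategy G i} → Winning W s₀ i σ → Winning W′ s₀ i σ
winning-map to from player₁ wins τ = to _ (wins τ)
winning-map to from player₂ wins σ = wins σ ∘ from _

averageThreshold : ∀ {k} → Instance k → ℚ
averageThreshold {EG} I = trivialThreshold (upper I)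
averageThreshold {AE} I = Instance.threshold I

averageObjective : ∀ {k} (I : Instance k) → Objective {Instance.game I}
averageObjective I π = EnergyLU (upper I) 0 π × AvgEnergy (averageThreshold I) π

toAverage : ∀ {k} (I : Instance k) π → objective I π → averageObjective I π
toAverage {EG} I π energy = energy , energy⇒average (upper I) π energy
toAverage {AE} I π w      = w

fromAverage : ∀ {k} (I : Instance k) π → averageObjective I π → objective I π
fromAverage {EG} I π (energy , _) = energy
fromAverage {AE} I π w            = w

memory-suffices : ∀ {k} i (I : Instance k) {b} →
                  suc (Game.#states (Instance.game I) * suc (upper I)) ≤ b →
                  Wins i I → WinsWithMemory i I b
memory-suffices i I ≤b (σ , wins) =
  let M , wins′ = AverageEnergy.finiteMemory (Instance.game I) (upper I) (averageThreshold I)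
        (Instance.initial I) i (σ , winning-map (toAverage I) (fromAverage I) i {σ} wins)
  in _ , ≤b , M , winning-map (fromAverage I) (toAverage I) i {Moore.strategy M} wins′

countingGame : Player → ℕ → Game
countingGame player₁ = Counting₁.G
countingGame player₂ = Counting₂.G

countingStart : ∀ i U → Game.State (countingGame i U)
countingStart player₁ U = zero
countingStart player₂ U = zero

countingThreshold : ∀ k → ℕ → Threshold k
countingThreshold EG U = tt
countingThreshold AE U = trivialThreshold U

counting : ∀ k → Player → ℕ → Instance k
counting k i U = record
  { game      = countingGame i U
  ; initial   = countingStart i U
  ; upper     = U
  ; threshold = countingThreshold k U
  }

counting-to : ∀ k i U π → objective (counting k i U) π → EnergyLU U 0 π
counting-to EG i U π w = w
counting-to AE i U π w = proj₁ w

counting-from : ∀ k i U π → EnergyLU U 0 π → objective (counting k i U) π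
counting-from EG i U π w = w
counting-from AE i U π w = w , energy⇒average U π w

counting-won : ∀ k i U → Wins i (counting k i U)
counting-won k player₁ U = Counting₁.climb U ,
  winning-map (counting-from k player₁ U) (counting-to k player₁ U) player₁
    {Counting₁.climb U} (Counting₁.climb-wins U)
counting-won k player₂ U = Counting₂.answer U ,
  winning-map (counting-from k player₂ U) (counting-to k player₂ U) player₂
    {Counting₂.answer U} (Counting₂.answer-wins U)

counting-memory : ∀ k i U m → WinningMachine i (counting k i U) m → U < m
counting-memory k player₁ U m (M , wins) = Counting₁.memory-bound U M
  (winning-map (counting-to k player₁ U) (counting-from k player₁ U) player₁ {Moore.strategy M} wins)
counting-memory k player₂ U m (M , wins) = Counting₂.memory-bound U M
  (winning-map (counting-to k player₂ U) (counting-from k player₂ U) player₂ {Moore.strategy M} wins)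

-- The case of `AE` and `player₂` attains this bound; its three logarithms come from the weight -U,
-- the threshold and the upper bound.
countingSize : Polynomial 1
countingSize = con 56 ⊕ con 3 ⊗ var zero

counting-size : ∀ k i U → size (counting k i U) ≤ eval₁ countingSize ⌊log₂ U ⌋
counting-size k i U = go k i
  where
  L = ⌊log₂ U ⌋

  energy₁ : ∀ L → 2 + (6 + (6 + L + (6 + 0))) + 0 + suc L + (35 + L) ≡ 56 + 3 * L
  energy₁ = ℕ-Solver.solve-∀

  energy₂ : ∀ L → 4 + (8 + (8 + (8 + L + (8 + (8 + (8 + 0)))))) + 0 + suc L + (3 + L) ≡ 56 + 3 * L
  energy₂ = ℕ-Solver.solve-∀

  average₁ : ∀ L → 2 + (6 + (6 + L + (6 + 0))) + (2 + L + 1) + suc L + 32 ≡ 56 + 3 * L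
  average₁ = ℕ-Solver.solve-∀

  average₂ : ∀ L → 4 + (8 + (8 + (8 + L + (8 + (8 + (8 + 0)))))) + (2 + L + 1) + suc L + 0 ≡ 56 + 3 * L
  average₂ = ℕ-Solver.solve-∀

  slack : ∀ {m n} d → m + d ≡ n → m ≤ n
  slack d eq = ≤-trans (m≤m+n _ d) (≤-reflexive eq)

  go : ∀ k i → size (counting k i U) ≤ eval₁ countingSize L
  go EG player₁ rewrite ℤ.∣-i∣≡∣i∣ (+ U) = slack (35 + L) (energy₁ L)
  go EG player₂ rewrite ℤ.∣-i∣≡∣i∣ (+ U) = slack (3 + L) (energy₂ L)
  go AE player₁ rewrite ℤ.∣-i∣≡∣i∣ (+ U) = slack 32 (average₁ L)
  go AE player₂ rewrite ℤ.∣-i∣≡∣i∣ (+ U) = slack 0 (average₂ L)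

#states≤size : ∀ {k} (I : Instance k) → Game.#states (Instance.game I) ≤ size I
#states≤size I = ≤-trans (m≤m+n _ _) (≤-trans (m≤m+n _ _) (m≤m+n _ _))

#states≤unarySize : ∀ {k} (I : Instance k) → Game.#states (Instance.game I) ≤ unarySize I
#states≤unarySize I = ≤-trans (m≤m+n _ _) (≤-trans (m≤m+n _ _) (m≤m+n _ _))

theorem9 : (k : Kind) (i : Player) →
    (∃ λ (p : Polynomial (#values k)) → (I : Instance k) → Wins i I →
    WinsWithMemory i I (eval p (values I)))
    ×
    (Σ (ℕ → Instance k) λ F →
    ((U : ℕ) → upper (F U) ≡ U)
    × ((U : ℕ) → Wins i (F U))
    × (∃ λ (p : Polynomial 1) → (U : ℕ) → size (F U) ≤ eval₁ p ⌊log₂ U ⌋)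
    × (∃ λ (a : ℕ) → ∃ λ (b : ℕ) → NonZero a × NonZero b ×
    (∃ λ (U₀ : ℕ) → (U : ℕ) → U₀ ≤ U →
    (m : ℕ) → WinningMachine i (F U) m → U ^ a ≤ m ^ b))
    × ((p : Polynomial 1) → ∃ λ (U : ℕ) →
    (m : ℕ) → WinningMachine i (F U) m → eval₁ p (size (F U)) < m))
    ×
    ((q : Polynomial 1) → ∃ λ (p : Polynomial 1) → (I : Instance k) →
    upper I ≤ eval₁ q (size I) → Wins i I →
    WinsWithMemory i I (eval₁ p (size I)))
    ×
    (∃ λ (p : Polynomial 1) → (I : Instance k) → Wins i I →
    WinsWithMemory i I (eval₁ p (unarySize I)))
theorem9 k i =
  (con 1 ⊕ var zero ⊗ (con 1 ⊕ var (suc (suc (suc zero)))) , λ I → memory-suffices i I ≤-refl) ,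
  (counting k i , (λ _ → refl) , counting-won k i , (countingSize , counting-size k i) ,
    (1 , 1 , _ , _ , 0 , λ U _ m machine → *-monoˡ-≤ 1 (<⇒≤ (counting-memory k i U m machine))) ,
    -- A doubly exponential U has logarithm `2 ^ r`, in which the size is polynomial.
    λ p → let r , eval< = eval<2^ p countingSize in 2 ^ (2 ^ r) , λ m machine →
      <-trans (eval< _ (subst (λ L → size (counting k i (2 ^ (2 ^ r))) ≤ eval₁ countingSize L)
        (⌊log₂[2^n]⌋≡n (2 ^ r)) (counting-size k i (2 ^ (2 ^ r)))))
        (counting-memory k i (2 ^ (2 ^ r)) m machine)) ,
  (λ q → con 1 ⊕ var zero ⊗ (con 1 ⊕ q) , λ I U≤ →
    memory-suffices i I (s≤s (*-mono-≤ (#states≤size I) (s≤s U≤)))) ,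
  (con 1 ⊕ var zero ⊗ (con 1 ⊕ var zero) , λ I →
    memory-suffices i I (s≤s (*-mono-≤ (#states≤unarySize I) (s≤s (m≤n+m _ _)))))
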